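{- Let $\mathcal{F}$ be a filter on $\omega$. Then $\mathcal{F}$ is $\mu_{\hat p}$-measurable if and only if $\mathcal{F}$ is $\mu_{\hat p}$-small.
   Context: Filters on $\omega$ are assumed nonprincipal and are identified with the set of characteristic functions of their elements, i.e. with subsets of $2^\omega$. For a sequence $\hat p = \{p_n : n\in\omega\}$ with $p_n \in (0,\tfrac12]$, $\mu_{\hat p}$ is the product measure on $2^\omega$ with $\mu_{\hat p}(\{x : x(n)=1\}) = p_n$ and $\mu_{\hat p}(\{x : x(n)=0\}) = 1-p_n$. A set $H\subseteq 2^\omega$ is $\mu_{\hat p}$-small if there exist a partition of $\omega$ into pairwise disjoint finite intervals $\{I_n : n\in\omega\}$ and sets $J_n\subseteq 2^{I_n}$ such that $H\subseteq\{x\in 2^\omega : \exists^\infty n\ x\restriction I_n\in J_n\}$ and $\sum_{n} \mu_{\hat p}(\{x\in 2^\omega : x\restriction I_n\in J_n\})<\infty$ (equivalently, the set $\{x : \exists^\infty n\ x\restriction I_n \in J_n\}$ has $\mu_{\hat p}$-measure zero). -}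

module Defs where

open import Level using (0ℓ)
open import Algebra.Bundles using (CommutativeRing)
import Algebra.Definitions.RawMonoid as RawMonoidDefinitions
open import Data.Bool.Base using (Bool; true; false; _∧_)
open import Data.Fin.Base using (toℕ)
open import Data.List.Base as List using (List; []; _∷_; [_]; _++_; filterᵇ; foldr)
open import Data.Nat.Base as ℕ using (ℕ; zero; suc)
open import Data.Product.Base using (∃; _×_; _,_; proj₁; proj₂)
open import Data.Sum.Base using (inj₁; inj₂)
open import Data.Vec.Base using (Vec; []; _∷_; tabulate)
open import Function.Base using (_∘_; const)
open import Function.Bundles using (_⇔_)
open import Relation.Binary.Core using (Rel)
import Relation.Binary.Construct.NonStrictToStrict as NonStrictToStrict
open import Relation.Binary.PropositionalEquality.Core using (_≡_; refl)
open import Relation.Binary.Structures using (IsTotalOrder)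
open import Relation.Nullary.Negation.Core using (¬_)
open import Relation.Unary using (Pred; _∈_; _⊆_; _∩_; ∁; ⋃)

module Bounds {A : Set} (_≤_ : Rel A 0ℓ) where

  UpperBound LowerBound : Pred A 0ℓ → Pred A 0ℓ
  UpperBound P b = ∀ {x} → x ∈ P → x ≤ b
  LowerBound P b = ∀ {x} → x ∈ P → b ≤ x

  IsSupremum IsInfimum : Pred A 0ℓ → Pred A 0ℓ
  IsSupremum P s = s ∈ UpperBound P × s ∈ LowerBound (UpperBound P)
  IsInfimum  P i = i ∈ LowerBound P × i ∈ UpperBound (LowerBound P)

-- The library has no real numbers; ℝ is taken to be any Dedekind-complete
-- ordered field, which determines it up to unique isomorphism.
record CompleteOrderedField : Set₁ where
  infix 4 _≤_
  field
    commutativeRing : CommutativeRing 0ℓ 0ℓ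
  open CommutativeRing commutativeRing public
  field
    0≉1          : ¬ (0# ≈ 1#)
    *-inverse    : ∀ x → ¬ (x ≈ 0#) → ∃ λ y → x * y ≈ 1#
    _≤_          : Rel Carrier 0ℓ
    isTotalOrder : IsTotalOrder _≈_ _≤_
    +-monoʳ-≤    : ∀ x {y z} → y ≤ z → x + y ≤ x + z
    *-nonNeg     : ∀ {x y} → 0# ≤ x → 0# ≤ y → 0# ≤ x * y

  open Bounds _≤_ public
  field
    supremum : ∀ P → ∃ P → ∃ (UpperBound P) → ∃ (IsSupremum P)

  infimum : ∀ P → ∃ P → ∃ (LowerBound P) → ∃ (IsInfimum P)
  infimum P (x , x∈P) bounded
    with i , upper , least ← supremum (LowerBound P) bounded (x , λ c≤P → c≤P x∈P)
    = i , (λ y∈P → least (λ c≤P → c≤P y∈P)) , upper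

  open NonStrictToStrict _≈_ _≤_ public using (_<_)
  open IsTotalOrder isTotalOrder public
    using (total; antisym; ≤-respʳ-≈; ≤-respˡ-≈)
    renaming (refl to ≤-refl; reflexive to ≤-reflexive; trans to ≤-trans)
  open RawMonoidDefinitions +-rawMonoid public using (sum)

  +-nonNeg : ∀ {x y} → 0# ≤ x → 0# ≤ y → 0# ≤ x + y
  +-nonNeg {x} 0≤x 0≤y =
    ≤-trans 0≤x (≤-respˡ-≈ (+-identityʳ x) (+-monoʳ-≤ x 0≤y))

  2≉0 : ¬ (1# + 1# ≈ 0#)
  2≉0 2≈0 with total 0# 1#
  ... | inj₁ 0≤1 = 0≉1 (antisym 0≤1
          (≤-respʳ-≈ 2≈0 (≤-respˡ-≈ (+-identityʳ 1#) (+-monoʳ-≤ 1# 0≤1))))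
  ... | inj₂ 1≤0 = 0≉1 (antisym
          (≤-respˡ-≈ 2≈0 (≤-respʳ-≈ (+-identityʳ 1#) (+-monoʳ-≤ 1# 1≤0))) 1≤0)

  ½ : Carrier
  ½ = proj₁ (*-inverse (1# + 1#) 2≉0)

  ½+½≈1 : ½ + ½ ≈ 1#
  ½+½≈1 = trans (sym (trans (distribʳ ½ 1# 1#) (+-cong (*-identityˡ ½) (*-identityˡ ½))))
                (proj₂ (*-inverse (1# + 1#) 2≉0))

  ⟨0,½] : Pred Carrier 0ℓ
  ⟨0,½] x = 0# < x × x ≤ ½

  partialSum : (ℕ → Carrier) → ℕ → Carrier
  partialSum a N = sum {N} (a ∘ toℕ)

  -- For a sequence of nonnegative terms: Σₙ a n ≤ r.
  Σ∞_≤_ : (ℕ → Carrier) → Carrier → Set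
  Σ∞ a ≤ r = ∀ N → partialSum a N ≤ r

  -- For a sequence of nonnegative terms: Σₙ a n < ∞.
  Summable : (ℕ → Carrier) → Set
  Summable a = ∃ λ r → Σ∞ a ≤ r

-- Points of 2^ω, identified with subsets of ω.
2^ω : Set
2^ω = ℕ → Bool

_⊑_ : Rel 2^ω 0ℓ
X ⊑ Y = ∀ n → X n ≡ true → Y n ≡ true

record IsFilter (F : Pred 2^ω 0ℓ) : Set where
  field
    whole        : const true ∈ F
    proper       : ¬ (const false ∈ F)
    intersection : ∀ {X Y} → X ∈ F → Y ∈ F → (λ n → X n ∧ Y n) ∈ F
    upward       : ∀ {X Y} → X ⊑ Y → X ∈ F → Y ∈ F

-- Not of the form {X : A ⊆ X}.  Every filter containing all cofinite sets is
-- nonprincipal in this sense, but not conversely.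
Nonprincipal : Pred 2^ω 0ℓ → Set
Nonprincipal F = ¬ (∃ λ A → ∀ X → X ∈ F ⇔ A ⊑ X)

-- The interval [start , start + length).
record Interval : Set where
  constructor ⟨_,_⟩
  field
    start  : ℕ
    length : ℕ

open Interval public

_∈ᴵ_ : ℕ → Interval → Set
k ∈ᴵ I = start I ℕ.≤ k × k ℕ.< start I ℕ.+ length I

record IsIntervalPartition (I : ℕ → Interval) : Set where
  field
    nonempty : ∀ n → 0 ℕ.< length (I n)
    covering : ∀ k → ∃ λ n → k ∈ᴵ I n
    disjoint : ∀ {m n k} → k ∈ᴵ I m → k ∈ᴵ I n → m ≡ n

-- Entry i of an element of 2^ I is its value at start I + i.
2^_ : Interval → Set
2^ I = Vec Bool (length I)

_↾_ : 2^ω → (I : Interval) → 2^ I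
x ↾ I = tabulate (λ i → x (start I ℕ.+ toℕ i))

-- An interval I together with (the characteristic function of) a set J ⊆ 2^ I.
record Cylinder : Set where
  constructor _,_
  field
    base : Interval
    set  : 2^ base → Bool

open Cylinder public

⟦_⟧ : Cylinder → Pred 2^ω 0ℓ
⟦ I , J ⟧ x = J (x ↾ I) ≡ true

words : ∀ n → List (Vec Bool n)
words zero    = [ [] ]
words (suc n) = List.map (false ∷_) (words n) ++ List.map (true ∷_) (words n)

module ProductMeasure
  (ℝ : CompleteOrderedField)
  (p : ℕ → CompleteOrderedField.Carrier ℝ)
  (p∈⟨0,½] : ∀ n → p n ∈ CompleteOrderedField.⟨0,½] ℝ)
  where

  open CompleteOrderedField ℝ hiding (refl)

  prob : ℕ → Bool → Carrier
  prob n true  = p n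
  prob n false = 1# - p n

  weight : ∀ {l} → ℕ → Vec Bool l → Carrier
  weight a []      = 1#
  weight a (b ∷ s) = prob a b * weight (suc a) s

  -- The product measure of a cylinder set: Σ_{s ∈ J} Π_{k ∈ I} prob k (s k).
  μ : Cylinder → Carrier
  μ (I , J) = foldr (λ s r → weight (start I) s + r) 0# (filterᵇ J (words (length I)))

  0≤½ : 0# ≤ ½
  0≤½ = ≤-trans (proj₁ (proj₁ (p∈⟨0,½] 0))) (proj₂ (p∈⟨0,½] 0))

  ½≤1 : ½ ≤ 1#
  ½≤1 = ≤-respʳ-≈ ½+½≈1 (≤-respˡ-≈ (+-identityʳ ½) (+-monoʳ-≤ ½ 0≤½))

  0≤1 : 0# ≤ 1#
  0≤1 = ≤-trans 0≤½ ½≤1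

  prob-nonNeg : ∀ n b → 0# ≤ prob n b
  prob-nonNeg n true  = proj₁ (proj₁ (p∈⟨0,½] n))
  prob-nonNeg n false =
    ≤-respʳ-≈ (+-comm (- p n) 1#)
      (≤-respˡ-≈ (-‿inverseˡ (p n))
        (+-monoʳ-≤ (- p n) (≤-trans (proj₂ (p∈⟨0,½] n)) ½≤1)))

  weight-nonNeg : ∀ {l} a (s : Vec Bool l) → 0# ≤ weight a s
  weight-nonNeg a []      = 0≤1
  weight-nonNeg a (b ∷ s) = *-nonNeg (prob-nonNeg a b) (weight-nonNeg (suc a) s)

  μ-nonNeg : ∀ C → 0# ≤ μ C
  μ-nonNeg (I , J) = go (filterᵇ J (words (length I)))
    where
    go : ∀ ss → 0# ≤ foldr (λ s r → weight (start I) s + r) 0# ss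
    go []       = ≤-refl
    go (s ∷ ss) = +-nonNeg (weight-nonNeg (start I) s) (go ss)

  -- r is at least the total measure of some countable cover of E by cylinders.
  CoverBound : Pred 2^ω 0ℓ → Pred Carrier 0ℓ
  CoverBound E r = ∃ λ (C : ℕ → Cylinder) →
    E ⊆ ⋃ ℕ (λ n → ⟦ C n ⟧) × (Σ∞ (μ ∘ C) ≤ r)

  trivialCover : ℕ → Cylinder
  trivialCover zero    = ⟨ 0 , 0 ⟩ , const true
  trivialCover (suc _) = ⟨ 0 , 0 ⟩ , const false

  zeros : ∀ N → sum {N} (λ _ → 0#) ≤ 0#
  zeros zero    = ≤-refl
  zeros (suc N) = ≤-respˡ-≈ (sym (+-identityˡ _)) (zeros N)

  coverBound-nonempty : ∀ E → ∃ (CoverBound E)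
  coverBound-nonempty E = μ (trivialCover 0) + 0# , trivialCover , (λ _ → 0 , refl) , bound
    where
    bound : Σ∞ (μ ∘ trivialCover) ≤ (μ (trivialCover 0) + 0#)
    bound zero    = +-nonNeg (μ-nonNeg (trivialCover 0)) ≤-refl
    bound (suc N) = +-monoʳ-≤ _ (zeros N)

  coverBound-bounded : ∀ E → ∃ (LowerBound (CoverBound E))
  coverBound-bounded E = 0# , λ { (C , _ , Σ≤r) → Σ≤r 0 }

  outer : ∀ E → ∃ (IsInfimum (CoverBound E))
  outer E = infimum (CoverBound E) (coverBound-nonempty E) (coverBound-bounded E)

  -- The outer measure induced by the product measure on cylinders.
  μ* : Pred 2^ω 0ℓ → Carrier
  μ* E = proj₁ (outer E)

  -- Carathéodory measurability, i.e. membership in the σ-algebra of the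
  -- completed product measure.
  Measurable : Pred 2^ω 0ℓ → Set₁
  Measurable H = ∀ (E : Pred 2^ω 0ℓ) → μ* E ≈ μ* (E ∩ H) + μ* (E ∩ ∁ H)

  Small : Pred 2^ω 0ℓ → Set
  Small H = ∃ λ (I : ℕ → Interval) → ∃ λ (J : ∀ n → 2^ (I n) → Bool) →
    IsIntervalPartition I ×
    (∀ {x} → x ∈ H → ∀ N → ∃ λ n → N ℕ.≤ n × J n (x ↾ I n) ≡ true) ×
    Summable (λ n → μ (I n , J n))

{-# OPTIONS --safe #-}
-- A small set is null by the tails of its cover, and null sets are measurable.
--
-- If a filter F is measurable with positive outer measure, some finite union of
-- cylinders contains only a small proportion of non-members, so some finite
-- initial segment u has most of its extensions in F.  Extend u to x and y by
-- drawing the pairs of bits (0,0), (1,0), (0,1) with probabilities 1 - 2p, p, p: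
-- both marginals are the product measure, so suitable choices give x and y in F
-- that are disjoint beyond u.  Then the finite set x ∩ y is in F, and F is
-- principal.
--
-- If F is null, there are consecutive blocks P₀, P₁, … and sets Sₖ depending on
-- Pₖ ∪ Pₖ₊₁ and of very small measure such that every member of F is in
-- infinitely many Sₖ.  The x having infinitely often on one of the two blocks a
-- restriction that makes the slice of Sₖ large form a small set.  If F is not
-- included in it, choose x ∈ F outside.  For z ∈ F, the set equal to x on
-- the even blocks and to z on the odd ones includes x ∩ z, so it is in F and
-- hence in infinitely many Sₖ; thus z on odd blocks is infinitely often in a
-- slice of Sₖ given by x, and those slices have small measure.
module Submission where

open import Level using (0ℓ)
open import Axiom.ExcludedMiddle using (ExcludedMiddle)
open import Data.Nat.Base using (ℕ)
open import Function.Bundles using (_⇔_)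
open import Relation.Unary using (Pred; _∈_)
open import Defs

open import Algebra.Bundles using (CommutativeRing)
open import Data.Bool.Base using (Bool; true; false; if_then_else_; not; _∧_; _∨_)
open import Data.Bool.Properties using (∧-conicalˡ; ∧-conicalʳ; ∨-zeroʳ)
open import Data.Empty using (⊥)
open import Data.Fin.Base using (toℕ)
open import Data.List.Base as List using (List; []; _∷_; _++_; filterᵇ; foldr)
open import Data.Nat.Base as ℕ using (zero; suc)
import Data.Nat.Properties as ℕₚ
open import Data.Product.Base using (∃; ∃₂; _×_; _,_; proj₁; proj₂)
open import Data.Sum.Base using (_⊎_; inj₁; inj₂)
open import Data.Vec.Base using (Vec; []; _∷_)
open import Data.Vec.Properties using (tabulate-cong)
open import Function.Base using (_∘_; const)
open import Function.Bundles using (mk⇔)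
open import Relation.Binary.Bundles using (Poset)
open import Relation.Binary.Definitions using (tri<; tri≈; tri>)
open import Relation.Binary.PropositionalEquality.Core as ≡ using (_≡_)
open import Relation.Binary.Structures using (IsTotalOrder)
open import Relation.Nullary using (¬_; Dec; yes; no; does; contradiction)
open import Relation.Nullary.Decidable using (decidable-stable)
open import Relation.Unary using (_⊆_; _∩_; _∪_; ∁; ⋃)

module FilterMeasure (em : ExcludedMiddle 0ℓ) (ℝ : CompleteOrderedField)
  (p : ℕ → CompleteOrderedField.Carrier ℝ)
  (p∈⟨0,½] : ∀ n → p n ∈ CompleteOrderedField.⟨0,½] ℝ) where

  open CompleteOrderedField ℝ hiding (zero)
  open ProductMeasure ℝ p p∈⟨0,½]
  open import Algebra.Solver.Ring.NaturalCoefficients.Default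
    (CommutativeRing.commutativeSemiring commutativeRing) using (solve; _:=_; _:+_; _:*_; con)

  ≤-poset : Poset 0ℓ 0ℓ 0ℓ
  ≤-poset = record { isPartialOrder = IsTotalOrder.isPartialOrder isTotalOrder }

  open import Relation.Binary.Reasoning.PartialOrder ≤-poset hiding (start)

  -- Classical logic and arithmetic in an ordered field

  stable : {P : Set} → ¬ ¬ P → P
  stable = decidable-stable em

  ¬∀⇒∃¬ : {A : Set} {P : A → Set} → ¬ (∀ x → P x) → ∃ λ x → ¬ P x
  ¬∀⇒∃¬ ¬∀ = stable λ ¬∃ → ¬∀ λ x → stable λ ¬Px → ¬∃ (x , ¬Px)

  ≰⇒≥ : ∀ {x y} → ¬ (x ≤ y) → y ≤ x
  ≰⇒≥ {x} {y} x≰y with total x y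
  ... | inj₁ x≤y = contradiction x≤y x≰y
  ... | inj₂ y≤x = y≤x

  <⇒≱ : ∀ {x y} → x < y → ¬ (y ≤ x)
  <⇒≱ (x≤y , x≉y) y≤x = x≉y (antisym x≤y y≤x)

  ≰⇒> : ∀ {x y} → ¬ (x ≤ y) → y < x
  ≰⇒> x≰y = ≰⇒≥ x≰y , λ y≈x → x≰y (≤-reflexive (sym y≈x))

  +-monoˡ-≤ : ∀ z {x y} → x ≤ y → x + z ≤ y + z
  +-monoˡ-≤ z {x} {y} x≤y = ≤-respʳ-≈ (+-comm z y) (≤-respˡ-≈ (+-comm z x) (+-monoʳ-≤ z x≤y))

  +-mono-≤ : ∀ {w x y z} → w ≤ x → y ≤ z → w + y ≤ x + z
  +-mono-≤ {x = x} {y} w≤x y≤z = ≤-trans (+-monoˡ-≤ y w≤x) (+-monoʳ-≤ x y≤z)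

  x+y-y≈x : ∀ x y → (x + y) + - y ≈ x
  x+y-y≈x x y = trans (+-assoc x y (- y)) (trans (+-congˡ (-‿inverseʳ y)) (+-identityʳ x))

  x-y+y≈x : ∀ x y → (x + - y) + y ≈ x
  x-y+y≈x x y = trans (+-assoc x (- y) y) (trans (+-congˡ (-‿inverseˡ y)) (+-identityʳ x))

  +-cancelʳ-≤ : ∀ z {x y} → x + z ≤ y + z → x ≤ y
  +-cancelʳ-≤ z {x} {y} le =
    ≤-respʳ-≈ (x+y-y≈x y z) (≤-respˡ-≈ (x+y-y≈x x z) (+-monoˡ-≤ (- z) le))

  +-cancelˡ-≤ : ∀ z {x y} → z + x ≤ z + y → x ≤ y
  +-cancelˡ-≤ z {x} {y} le = +-cancelʳ-≤ z (≤-respʳ-≈ (+-comm z y) (≤-respˡ-≈ (+-comm z x) le))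

  x≤y+z⇒x-z≤y : ∀ {x y z} → x ≤ y + z → x + - z ≤ y
  x≤y+z⇒x-z≤y {x} {y} {z} le = +-cancelʳ-≤ z (≤-respˡ-≈ (sym (x-y+y≈x x z)) le)

  x-z≤y⇒x≤y+z : ∀ {x y z} → x + - z ≤ y → x ≤ y + z
  x-z≤y⇒x≤y+z {x} {y} {z} le = ≤-respˡ-≈ (x-y+y≈x x z) (+-monoˡ-≤ z le)

  x≤y⇒0≤y-x : ∀ {x y} → x ≤ y → 0# ≤ y + - x
  x≤y⇒0≤y-x {x} {y} x≤y = ≤-respˡ-≈ (-‿inverseʳ x) (+-monoˡ-≤ (- x) x≤y)

  x≤x+y : ∀ {x y} → 0# ≤ y → x ≤ x + y
  x≤x+y {x} 0≤y = ≤-respˡ-≈ (+-identityʳ x) (+-monoʳ-≤ x 0≤y)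

  x≤y+x : ∀ {x y} → 0# ≤ y → x ≤ y + x
  x≤y+x {x} {y} 0≤y = ≤-respʳ-≈ (+-comm x y) (x≤x+y 0≤y)

  x+y≰x : ∀ {x y} → 0# < y → ¬ (x + y ≤ x)
  x+y≰x {x} {y} 0<y le = <⇒≱ 0<y (+-cancelˡ-≤ x (≤-respʳ-≈ (sym (+-identityʳ x)) le))

  *-monoˡ-≤ : ∀ {z x y} → 0# ≤ z → x ≤ y → z * x ≤ z * y
  *-monoˡ-≤ {z} {x} {y} 0≤z x≤y =
    ≤-respʳ-≈ (trans (sym (distribˡ z x (y + - x))) (*-congˡ (trans (+-comm _ _) (x-y+y≈x y x))))
      (x≤x+y (*-nonNeg 0≤z (x≤y⇒0≤y-x x≤y)))

  *-monoʳ-≤ : ∀ {z x y} → 0# ≤ z → x ≤ y → x * z ≤ y * z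
  *-monoʳ-≤ {z} {x} {y} 0≤z x≤y =
    ≤-respʳ-≈ (*-comm z y) (≤-respˡ-≈ (*-comm z x) (*-monoˡ-≤ 0≤z x≤y))

  0<⇒≉0 : ∀ {x} → 0# < x → ¬ (x ≈ 0#)
  0<⇒≉0 (_ , 0≉x) x≈0 = 0≉x (sym x≈0)

  *-cancelʳ-≈ : ∀ {z x y} → 0# < z → x * z ≈ y * z → x ≈ y
  *-cancelʳ-≈ {z} {x} {y} 0<z eq with z⁻¹ , zz⁻¹≈1 ← *-inverse z (0<⇒≉0 0<z) =
      trans (sym (lem x)) (trans (*-congʳ eq) (lem y))
    where
    lem : ∀ u → (u * z) * z⁻¹ ≈ u
    lem u = trans (*-assoc u z z⁻¹) (trans (*-congˡ zz⁻¹≈1) (*-identityʳ u))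

  *-cancelʳ-≤ : ∀ {z x y} → 0# < z → x * z ≤ y * z → x ≤ y
  *-cancelʳ-≤ {z} {x} {y} 0<z le with total x y
  ... | inj₁ x≤y = x≤y
  ... | inj₂ y≤x = ≤-reflexive (*-cancelʳ-≈ 0<z (antisym le (*-monoʳ-≤ (proj₁ 0<z) y≤x)))

  *-pos : ∀ {x y} → 0# < x → 0# < y → 0# < x * y
  *-pos {x} {y} (0≤x , 0≉x) 0<y@(0≤y , _) =
    *-nonNeg 0≤x 0≤y , λ 0≈xy → 0≉x (*-cancelʳ-≈ 0<y (trans (zeroˡ y) 0≈xy))

  -- This is 2 to the power -(k + 1); starting at `½` makes the total 1.
  ε : ℕ → Carrier
  ε zero    = ½
  ε (suc k) = ε k * ½

  0<p : ∀ n → 0# < p n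
  0<p n = proj₁ (p∈⟨0,½] n)

  0<½ : 0# < ½
  0<½ = 0≤½ , λ 0≈½ → proj₂ (0<p 0) (antisym (proj₁ (0<p 0)) (≤-respʳ-≈ (sym 0≈½) (proj₂ (p∈⟨0,½] 0))))

  0<ε : ∀ k → 0# < ε k
  0<ε zero    = 0<½
  0<ε (suc k) = *-pos (0<ε k) 0<½

  -- Series of nonnegative terms

  infix 5 _↑_
  _↑_ : {A : Set} → (ℕ → A) → ℕ → ℕ → A
  (a ↑ m) n = a (m ℕ.+ n)

  partialSum-mono : ∀ {a b : ℕ → Carrier} → (∀ i → a i ≤ b i) → ∀ N → partialSum a N ≤ partialSum b N
  partialSum-mono a≤b zero    = ≤-refl
  partialSum-mono a≤b (suc N) = +-mono-≤ (a≤b 0) (partialSum-mono (a≤b ∘ suc) N)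

  partialSum-cong : ∀ {a b : ℕ → Carrier} → (∀ i → a i ≈ b i) → ∀ N → partialSum a N ≈ partialSum b N
  partialSum-cong a≈b N =
    antisym (partialSum-mono (≤-reflexive ∘ a≈b) N) (partialSum-mono (≤-reflexive ∘ sym ∘ a≈b) N)

  partialSum-nonNeg : ∀ {a : ℕ → Carrier} → (∀ i → 0# ≤ a i) → ∀ N → 0# ≤ partialSum a N
  partialSum-nonNeg 0≤a zero    = ≤-refl
  partialSum-nonNeg 0≤a (suc N) = +-nonNeg (0≤a 0) (partialSum-nonNeg (0≤a ∘ suc) N)

  partialSum-+ : ∀ (a b : ℕ → Carrier) N →
    partialSum (λ i → a i + b i) N ≈ partialSum a N + partialSum b N
  partialSum-+ a b zero    = sym (+-identityˡ 0#)
  partialSum-+ a b (suc N) = trans (+-congˡ (partialSum-+ (a ∘ suc) (b ∘ suc) N))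
    (solve 4 (λ w x y z → (w :+ x) :+ (y :+ z) := (w :+ y) :+ (x :+ z)) refl (a 0) (b 0) _ _)

  partialSum-* : ∀ c (a : ℕ → Carrier) N → partialSum (λ i → c * a i) N ≈ c * partialSum a N
  partialSum-* c a zero    = sym (zeroʳ c)
  partialSum-* c a (suc N) = trans (+-congˡ (partialSum-* c (a ∘ suc) N)) (sym (distribˡ c _ _))

  partialSum-↑ : ∀ (a : ℕ → Carrier) M N →
    partialSum a (M ℕ.+ N) ≈ partialSum a M + partialSum (a ↑ M) N
  partialSum-↑ a zero    N = sym (+-identityˡ _)
  partialSum-↑ a (suc M) N = trans (+-congˡ (partialSum-↑ (a ∘ suc) M N)) (sym (+-assoc _ _ _))

  partialSum-grows : ∀ {a : ℕ → Carrier} → (∀ i → 0# ≤ a i) →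
    ∀ {M N} → M ℕ.≤ N → partialSum a M ≤ partialSum a N
  partialSum-grows 0≤a {N = N} ℕ.z≤n       = partialSum-nonNeg 0≤a N
  partialSum-grows 0≤a (ℕ.s≤s M≤N) = +-monoʳ-≤ _ (partialSum-grows (0≤a ∘ suc) M≤N)

  term≤partialSum : ∀ {a : ℕ → Carrier} → (∀ i → 0# ≤ a i) → ∀ {i N} → i ℕ.< N → a i ≤ partialSum a N
  term≤partialSum 0≤a {zero} {suc N} _ = x≤x+y (partialSum-nonNeg (0≤a ∘ suc) N)
  term≤partialSum 0≤a {suc i} {suc N} (ℕ.s≤s i<N) = ≤-trans (term≤partialSum (0≤a ∘ suc) i<N) (x≤y+x (0≤a 0))

  Σε≤1 : Σ∞ ε ≤ 1#
  Σε≤1 zero    = 0≤1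
  Σε≤1 (suc N) = begin
    ½ + partialSum (λ k → ε k * ½) N ≈⟨ +-congˡ (trans (partialSum-cong (λ k → *-comm (ε k) ½) N) (partialSum-* ½ ε N)) ⟩
    ½ + ½ * partialSum ε N           ≤⟨ +-monoʳ-≤ ½ (*-monoˡ-≤ 0≤½ (Σε≤1 N)) ⟩
    ½ + ½ * 1#                       ≈⟨ +-congˡ (*-identityʳ ½) ⟩
    ½ + ½                            ≈⟨ ½+½≈1 ⟩
    1#                               ∎

  -- Some partial sum comes within `δ` of the supremum `s` of all partial sums, since otherwise
  -- `s - δ` would be a smaller upper bound. What follows that partial sum adds up to at most `δ`.
  Σ∞-tail : ∀ {a : ℕ → Carrier} → (∀ i → 0# ≤ a i) → ∀ {r} → Σ∞ a ≤ r →
    ∀ δ → 0# < δ → ∃ λ M → Σ∞ (a ↑ M) ≤ δ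
  Σ∞-tail {a} 0≤a {r} Σa≤r δ 0<δ
    with s , upper , least ← supremum (λ y → ∃ λ N → y ≡ partialSum a N)
           (_ , 0 , ≡.refl) (r , λ { (N , ≡.refl) → Σa≤r N })
    with em {∃ λ M → s ≤ partialSum a M + δ}
  ... | yes (M , s≤) = M , λ N → +-cancelˡ-≤ (partialSum a M)
          (≤-respˡ-≈ (partialSum-↑ a M N) (≤-trans (upper (M ℕ.+ N , ≡.refl)) s≤))
  ... | no ¬close = contradiction
          (≤-respʳ-≈ (x-y+y≈x s δ) (+-monoˡ-≤ δ (least λ { (M , ≡.refl) → below M }))) (x+y≰x 0<δ)
    where
    below : ∀ M → partialSum a M ≤ s + - δ
    below M = +-cancelʳ-≤ δ (≤-respʳ-≈ (sym (x-y+y≈x s δ)) (≰⇒≥ λ le → ¬close (M , le)))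

  interleave : {A : Set} → (ℕ → A) → (ℕ → A) → ℕ → A
  interleave a b zero    = a 0
  interleave a b (suc n) = interleave b (a ∘ suc) n

  partialSum-interleave : ∀ {A : Set} {μ : A → Carrier} → (∀ c → 0# ≤ μ c) → (a b : ℕ → A) → ∀ N →
    partialSum (μ ∘ interleave a b) N ≤ partialSum (μ ∘ a) N + partialSum (μ ∘ b) N
  partialSum-interleave 0≤μ a b zero    = ≤-reflexive (sym (+-identityˡ 0#))
  partialSum-interleave {μ = μ} 0≤μ a b (suc N) = begin
    μ (a 0) + partialSum (μ ∘ interleave b (a ∘ suc)) N
      ≤⟨ +-monoʳ-≤ _ (partialSum-interleave 0≤μ b (a ∘ suc) N) ⟩
    μ (a 0) + (partialSum (μ ∘ b) N + partialSum (μ ∘ a ∘ suc) N)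
      ≈⟨ solve 3 (λ x y z → x :+ (y :+ z) := (x :+ z) :+ y) refl _ _ _ ⟩
    partialSum (μ ∘ a) (suc N) + partialSum (μ ∘ b) N
      ≤⟨ +-monoʳ-≤ _ (partialSum-grows (0≤μ ∘ b) (ℕₚ.n≤1+n N)) ⟩
    partialSum (μ ∘ a) (suc N) + partialSum (μ ∘ b) (suc N) ∎

  interleave-∃ˡ : ∀ {A : Set} (a b : ℕ → A) i → ∃ λ n → interleave a b n ≡ a i
  interleave-∃ʳ : ∀ {A : Set} (a b : ℕ → A) i → ∃ λ n → interleave a b n ≡ b i
  interleave-∃ˡ a b zero    = 0 , ≡.refl
  interleave-∃ˡ a b (suc i) with n , eq ← interleave-∃ʳ b (a ∘ suc) i = suc n , eq
  interleave-∃ʳ a b i with n , eq ← interleave-∃ˡ b (a ∘ suc) i = suc n , eq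

  -- If both series exceeded `r`, both would do so at a common index, and there the smaller partial
  -- sum is at most the weighted average, hence at most `r`. This is the selection principle behind
  -- every choice of a bit: one choice keeps a whole series bounded.
  convexCombination-choice : ∀ {α β r} {t u : ℕ → Carrier} →
    0# ≤ α → 0# ≤ β → α + β ≈ 1# → (∀ i → 0# ≤ t i) → (∀ i → 0# ≤ u i) →
    Σ∞ (λ i → α * t i + β * u i) ≤ r → (Σ∞ t ≤ r) ⊎ (Σ∞ u ≤ r)
  convexCombination-choice {α} {β} {r} {t} {u} 0≤α 0≤β α+β≈1 0≤t 0≤u Σ≤r
    with em {Σ∞ t ≤ r} | em {Σ∞ u ≤ r}
  ... | yes Σt≤r | _        = inj₁ Σt≤r
  ... | no _     | yes Σu≤r = inj₂ Σu≤r
  ... | no Σt≰r  | no Σu≰r  = contradiction minBounded λ { (inj₁ le) → t≰ le ; (inj₂ le) → u≰ le }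
    where
    M N : ℕ
    M = proj₁ (¬∀⇒∃¬ Σt≰r)
    N = proj₁ (¬∀⇒∃¬ Σu≰r)
    T U : Carrier
    T = partialSum t (M ℕ.+ N)
    U = partialSum u (M ℕ.+ N)
    t≰ : ¬ (T ≤ r)
    t≰ le = proj₂ (¬∀⇒∃¬ Σt≰r) (≤-trans (partialSum-grows 0≤t (ℕₚ.m≤m+n M N)) le)
    u≰ : ¬ (U ≤ r)
    u≰ le = proj₂ (¬∀⇒∃¬ Σu≰r) (≤-trans (partialSum-grows 0≤u (ℕₚ.m≤n+m N M)) le)
    average : α * T + β * U ≤ r
    average = ≤-respˡ-≈ (trans (partialSum-+ (λ i → α * t i) (λ i → β * u i) (M ℕ.+ N))
      (+-cong (partialSum-* α t (M ℕ.+ N)) (partialSum-* β u (M ℕ.+ N)))) (Σ≤r (M ℕ.+ N))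
    constant : ∀ x → α * x + β * x ≈ x
    constant x = trans (sym (distribʳ x α β)) (trans (*-congʳ α+β≈1) (*-identityˡ x))
    minBounded : T ≤ r ⊎ U ≤ r
    minBounded with total T U
    ... | inj₁ T≤U = inj₁ (≤-trans (≤-respˡ-≈ (constant T) (+-monoʳ-≤ _ (*-monoˡ-≤ 0≤β T≤U))) average)
    ... | inj₂ U≤T = inj₂ (≤-trans (≤-respˡ-≈ (constant U) (+-monoˡ-≤ _ (*-monoˡ-≤ 0≤α U≤T))) average)

  -- Averages over blocks of coordinates

  infixl 8 _[_≔_]
  _[_≔_] : 2^ω → ℕ → Bool → 2^ω
  (x [ k ≔ b ]) i with i ℕₚ.≟ k
  ... | yes _ = b
  ... | no _  = x i

  [≔]-updates : ∀ x k b {i} → i ≡ k → (x [ k ≔ b ]) i ≡ b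
  [≔]-updates x k b {i} i≡k with i ℕₚ.≟ k
  ... | yes _  = ≡.refl
  ... | no i≢k = contradiction i≡k i≢k

  [≔]-minimal : ∀ x k b {i} → ¬ (i ≡ k) → (x [ k ≔ b ]) i ≡ x i
  [≔]-minimal x k b {i} i≢k with i ℕₚ.≟ k
  ... | yes i≡k = contradiction i≡k i≢k
  ... | no _    = ≡.refl

  [≔]-comm : ∀ x {k l} b c → ¬ (k ≡ l) → ∀ i → (x [ k ≔ b ] [ l ≔ c ]) i ≡ (x [ l ≔ c ] [ k ≔ b ]) i
  [≔]-comm x {k} {l} b c k≢l i = go (i ℕₚ.≟ k) (i ℕₚ.≟ l)
    where
    go : Dec (i ≡ k) → Dec (i ≡ l) → (x [ k ≔ b ] [ l ≔ c ]) i ≡ (x [ l ≔ c ] [ k ≔ b ]) i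
    go (yes i≡k) (yes i≡l) = contradiction (≡.trans (≡.sym i≡k) i≡l) k≢l
    go (yes i≡k) (no i≢l)  = ≡.trans ([≔]-minimal _ l c i≢l)
      (≡.trans ([≔]-updates x k b i≡k) (≡.sym ([≔]-updates _ k b i≡k)))
    go (no i≢k)  (yes i≡l) = ≡.trans ([≔]-updates _ l c i≡l)
      (≡.sym (≡.trans ([≔]-minimal _ k b i≢k) ([≔]-updates x l c i≡l)))
    go (no i≢k)  (no i≢l)  = ≡.trans (≡.trans ([≔]-minimal _ l c i≢l) ([≔]-minimal x k b i≢k))
      (≡.sym (≡.trans ([≔]-minimal _ k b i≢k) ([≔]-minimal x l c i≢l)))

  prob-sum : ∀ k → prob k false + prob k true ≈ 1#
  prob-sum k = x-y+y≈x 1# (p k)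

  p≤prob : ∀ k b → p k ≤ prob k b
  p≤prob k true  = ≤-refl
  p≤prob k false = +-cancelʳ-≤ (p k) (begin
    p k + p k             ≤⟨ +-mono-≤ (proj₂ (p∈⟨0,½] k)) (proj₂ (p∈⟨0,½] k)) ⟩
    ½ + ½                 ≈⟨ ½+½≈1 ⟩
    1#                    ≈⟨ prob-sum k ⟨
    prob k false + p k    ∎)

  RealFun : Set
  RealFun = 2^ω → Carrier

  E₁ : ℕ → RealFun → RealFun
  E₁ k f x = prob k false * f (x [ k ≔ false ]) + prob k true * f (x [ k ≔ true ])

  -- E k m f x averages f over the coordinates in [k , k + m), the other
  -- coordinates being taken from x.
  E : ℕ → ℕ → RealFun → RealFun
  E k zero    f = f
  E k (suc m) f = E₁ k (E (suc k) m f)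

  E₁-mono : ∀ k {f g : RealFun} → (∀ x → f x ≤ g x) → ∀ x → E₁ k f x ≤ E₁ k g x
  E₁-mono k f≤g x = +-mono-≤ (*-monoˡ-≤ (prob-nonNeg k false) (f≤g _))
      (*-monoˡ-≤ (prob-nonNeg k true) (f≤g _))

  E₁-const : ∀ k c x → E₁ k (const c) x ≈ c
  E₁-const k c x = trans (sym (distribʳ c _ _)) (trans (*-congʳ (prob-sum k)) (*-identityˡ c))

  E₁-cong : ∀ k {f g : RealFun} → (∀ x → f x ≈ g x) → ∀ x → E₁ k f x ≈ E₁ k g x
  E₁-cong k f≈g x = +-cong (*-congˡ (f≈g _)) (*-congˡ (f≈g _))

  E₁-+ : ∀ k (f g : RealFun) x → E₁ k (λ y → f y + g y) x ≈ E₁ k f x + E₁ k g x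
  E₁-+ k f g x = solve 6 (λ q r a b c d → q :* (a :+ b) :+ r :* (c :+ d) := (q :* a :+ r :* c) :+ (q :* b :+ r :* d))
    refl _ _ _ _ _ _

  E₁-* : ∀ k (f : RealFun) c x → E₁ k (λ y → f y * c) x ≈ E₁ k f x * c
  E₁-* k f c x = solve 5 (λ q r a b c → q :* (a :* c) :+ r :* (b :* c) := (q :* a :+ r :* b) :* c)
    refl _ _ _ _ _

  E-mono : ∀ k m {f g : RealFun} → (∀ x → f x ≤ g x) → ∀ x → E k m f x ≤ E k m g x
  E-mono k zero    f≤g = f≤g
  E-mono k (suc m) f≤g = E₁-mono k (E-mono (suc k) m f≤g)

  E-cong : ∀ k m {f g : RealFun} → (∀ x → f x ≈ g x) → ∀ x → E k m f x ≈ E k m g x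
  E-cong k zero    f≈g = f≈g
  E-cong k (suc m) f≈g = E₁-cong k (E-cong (suc k) m f≈g)

  E-const : ∀ k m c x → E k m (const c) x ≈ c
  E-const k zero    c x = refl
  E-const k (suc m) c x = trans (E₁-cong k (E-const (suc k) m c) x) (E₁-const k c x)

  E-nonNeg : ∀ k m {f : RealFun} → (∀ x → 0# ≤ f x) → ∀ x → 0# ≤ E k m f x
  E-nonNeg k m 0≤f x = ≤-respˡ-≈ (E-const k m 0# x) (E-mono k m 0≤f x)

  E-+ : ∀ k m (f g : RealFun) x → E k m (λ y → f y + g y) x ≈ E k m f x + E k m g x
  E-+ k zero    f g x = refl
  E-+ k (suc m) f g x = trans (E₁-cong k (E-+ (suc k) m f g) x) (E₁-+ k (E (suc k) m f) (E (suc k) m g) x)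

  E-* : ∀ k m (f : RealFun) c x → E k m (λ y → f y * c) x ≈ E k m f x * c
  E-* k zero    f c x = refl
  E-* k (suc m) f c x = trans (E₁-cong k (E-* (suc k) m f c) x) (E₁-* k (E (suc k) m f) c x)

  -- The start of the second interval is a variable with an equation because the recursion replaces
  -- `k + suc m` by `suc k + m`, which is only propositionally equal to it.
  E-++ : ∀ k m n {l} (f : RealFun) → l ≡ k ℕ.+ m → ∀ x → E k (m ℕ.+ n) f x ≈ E k m (E l n f) x
  E-++ k zero    n f eq x rewrite eq | ℕₚ.+-identityʳ k = refl
  E-++ k (suc m) n f eq x = E₁-cong k (E-++ (suc k) m n f (≡.trans eq (ℕₚ.+-suc k m))) x

  DependsOn : Pred ℕ 0ℓ → RealFun → Set
  DependsOn S f = ∀ {x y} → (∀ i → i ∈ S → x i ≡ y i) → f x ≈ f y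

  -- Pointwise equal points need not be propositionally equal, so respecting pointwise equality has
  -- to be asked of a function.
  Extensional : RealFun → Set
  Extensional f = ∀ {x y} → (∀ i → x i ≡ y i) → f x ≈ f y

  extensional : ∀ {S f} → DependsOn S f → Extensional f
  extensional dep x≐y = dep λ i _ → x≐y i

  _∈[_,+_⟩ : ℕ → ℕ → ℕ → Set
  i ∈[ k ,+ m ⟩ = k ℕ.≤ i × i ℕ.< k ℕ.+ m

  E-dependsOn : ∀ k m {f S} {T : Pred ℕ 0ℓ} → DependsOn S f →
    (∀ i → i ∈ S → ¬ (i ∈[ k ,+ m ⟩) → i ∈ T) → DependsOn T (E k m f)
  E-dependsOn k zero    dep S⊆T x≐y =
    dep λ i i∈S → x≐y i (S⊆T i i∈S λ (k≤i , i<k) → ℕₚ.<⇒≱ i<k (≡.subst (ℕ._≤ i) (≡.sym (ℕₚ.+-identityʳ k)) k≤i))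
  E-dependsOn k (suc m) {f} {S} {T} dep S⊆T {x} {y} x≐y = +-cong (*-congˡ (lem false)) (*-congˡ (lem true))
    where
    lem : ∀ b → E (suc k) m f (x [ k ≔ b ]) ≈ E (suc k) m f (y [ k ≔ b ])
    -- The recursive call takes for `T` all of `S` outside the shorter interval. This may contain
    -- `k`, where both updated points have the bit `b`.
    lem b = E-dependsOn (suc k) m {S = S} dep (λ i i∈S i∉ → i∈S , i∉) agree
      where
      agree : ∀ i → i ∈ S × ¬ (i ∈[ suc k ,+ m ⟩) → (x [ k ≔ b ]) i ≡ (y [ k ≔ b ]) i
      agree i (i∈S , i∉) with i ℕₚ.≟ k
      ... | yes _  = ≡.refl
      ... | no i≢k = x≐y i (S⊆T i i∈S λ (k≤i , i<) →
              i∉ (ℕₚ.≤∧≢⇒< k≤i (i≢k ∘ ≡.sym) , ≡.subst (i ℕ.<_) (ℕₚ.+-suc k m) i<))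

  E-extensional : ∀ k m {f} → Extensional f → Extensional (E k m f)
  E-extensional k m ext {x} {y} x≐y =
    -- Extensionality is dependence on the set of all coordinates, here written `0 ≡ 0`.
    E-dependsOn k m {S = λ _ → 0 ≡ 0} {T = λ _ → 0 ≡ 0}
        (λ a → ext λ i → a i ≡.refl) (λ _ _ _ → ≡.refl) (λ i _ → x≐y i)

  E-independent : ∀ k m {f S} → DependsOn S f → (∀ i → i ∈ S → ¬ (i ∈[ k ,+ m ⟩)) → ∀ x → E k m f x ≈ f x
  E-independent k zero    dep disj x = refl
  E-independent k (suc m) {f} {S} dep disj x =
    trans (+-cong (*-congˡ (lem false)) (*-congˡ (lem true))) (E₁-const k (f x) x)
    where
    disj′ : ∀ i → i ∈ S → ¬ (i ∈[ suc k ,+ m ⟩)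
    disj′ i i∈S (k<i , i<) = disj i i∈S (ℕₚ.<⇒≤ k<i , ≡.subst (i ℕ.<_) (≡.sym (ℕₚ.+-suc k m)) i<)
    lem : ∀ b → E (suc k) m f (x [ k ≔ b ]) ≈ f x
    lem b = trans (E-independent (suc k) m {S = S} dep disj′ _)
      (dep λ i i∈S → [≔]-minimal x k b λ { ≡.refl → disj i i∈S (ℕₚ.≤-refl , ℕₚ.m<m+n i (ℕ.s≤s ℕ.z≤n)) })

  E₁-comm : ∀ k l {f} → ¬ (k ≡ l) → Extensional f → ∀ x → E₁ k (E₁ l f) x ≈ E₁ l (E₁ k f) x
  E₁-comm k l {f} k≢l ext x = trans
    (+-cong (*-congˡ (+-cong (*-congˡ (swap false false)) (*-congˡ (swap false true))))
            (*-congˡ (+-cong (*-congˡ (swap true false)) (*-congˡ (swap true true)))))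
    (solve 8 (λ q r s t a b c d →
       q :* (s :* a :+ t :* b) :+ r :* (s :* c :+ t :* d) := s :* (q :* a :+ r :* c) :+ t :* (q :* b :+ r :* d))
     refl _ _ _ _ _ _ _ _)
    where
    swap : ∀ b c → f (x [ k ≔ b ] [ l ≔ c ]) ≈ f (x [ l ≔ c ] [ k ≔ b ])
    swap b c = ext ([≔]-comm x b c k≢l)

  E₁-E-comm : ∀ k l n {f} → ¬ (k ∈[ l ,+ n ⟩) → Extensional f → ∀ x → E₁ k (E l n f) x ≈ E l n (E₁ k f) x
  E₁-E-comm k l zero    k∉ ext x = refl
  E₁-E-comm k l (suc n) {f} k∉ ext x = trans
    (E₁-comm k l {E (suc l) n f} (λ { ≡.refl → k∉ (ℕₚ.≤-refl , ℕₚ.m<m+n k (ℕ.s≤s ℕ.z≤n)) })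
        (E-extensional (suc l) n ext) x)
    (E₁-cong l (E₁-E-comm k (suc l) n (λ (l<k , k<) →
      k∉ (ℕₚ.<⇒≤ l<k , ≡.subst (k ℕ.<_) (≡.sym (ℕₚ.+-suc l n)) k<)) ext) x)

  -- Fubini for finite averages: the intervals are disjoint, so the single-coordinate averages
  -- commute one by one.
  E-comm : ∀ k m l n {f} → k ℕ.+ m ℕ.≤ l → Extensional f → ∀ x → E k m (E l n f) x ≈ E l n (E k m f) x
  E-comm k zero    l n k+m≤l ext x = refl
  E-comm k (suc m) l n {f} k+m≤l ext x = trans
    (E₁-cong k (E-comm (suc k) m l n sk+m≤l ext) x)
    (E₁-E-comm k l n {E (suc k) m f} (λ (l≤k , _) → ℕₚ.<⇒≱ (ℕₚ.≤-trans (ℕₚ.m≤m+n (suc k) m) sk+m≤l) l≤k)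
        (E-extensional (suc k) m ext) x)
    where
    sk+m≤l : suc k ℕ.+ m ℕ.≤ l
    sk+m≤l = ≡.subst (ℕ._≤ l) (ℕₚ.+-suc k m) k+m≤l

  -- The weight of the word of ones, which is the least weight of a word on this interval because
  -- every `p n` is at most `½`.
  minWeight : ℕ → ℕ → Carrier
  minWeight k zero    = 1#
  minWeight k (suc m) = p k * minWeight (suc k) m

  minWeight-pos : ∀ k m → 0# < minWeight k m
  minWeight-pos k zero    = 0≤1 , 0≉1
  minWeight-pos k (suc m) = *-pos (0<p k) (minWeight-pos (suc k) m)

  -- Of all the nonnegative terms of the average, only the one given by the bits of `x` itself is
  -- kept.
  E-minWeight : ∀ k m {f} → Extensional f → (∀ x → 0# ≤ f x) → ∀ x → minWeight k m * f x ≤ E k m f x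
  E-minWeight k zero    ext 0≤f x = ≤-reflexive (*-identityˡ _)
  E-minWeight k (suc m) {f} ext 0≤f x = begin
    (p k * minWeight (suc k) m) * f x   ≈⟨ *-assoc _ _ _ ⟩
    p k * (minWeight (suc k) m * f x)   ≤⟨ *-monoˡ-≤ (proj₁ (0<p k)) (E-minWeight (suc k) m ext 0≤f x) ⟩
    p k * E (suc k) m f x               ≤⟨ *-monoʳ-≤ (0≤E x) (p≤prob k (x k)) ⟩
    prob k (x k) * E (suc k) m f x      ≈⟨ *-congˡ (E-extensional (suc k) m ext same) ⟩
    prob k (x k) * E (suc k) m f (x [ k ≔ x k ]) ≤⟨ summand (x k) ⟩
    E₁ k (E (suc k) m f) x              ∎
    where
    0≤E : ∀ x → 0# ≤ E (suc k) m f x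
    0≤E = E-nonNeg (suc k) m 0≤f
    same : ∀ i → x i ≡ (x [ k ≔ x k ]) i
    same i with i ℕₚ.≟ k
    ... | yes ≡.refl = ≡.refl
    ... | no _       = ≡.refl
    summand : ∀ b → prob k b * E (suc k) m f (x [ k ≔ b ]) ≤ E₁ k (E (suc k) m f) x
    summand false = x≤x+y (*-nonNeg (prob-nonNeg k true) (0≤E _))
    summand true  = x≤y+x (*-nonNeg (prob-nonNeg k false) (0≤E _))

  -- Indicators and cylinder measures

  𝟙 : Bool → Carrier
  𝟙 true  = 1#
  𝟙 false = 0#

  0≤𝟙 : ∀ b → 0# ≤ 𝟙 b
  0≤𝟙 true  = 0≤1
  0≤𝟙 false = ≤-refl

  𝟙-∨ : ∀ a b → 𝟙 (a ∨ b) ≤ 𝟙 a + 𝟙 b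
  𝟙-∨ true  b = x≤x+y (0≤𝟙 b)
  𝟙-∨ false b = x≤y+x ≤-refl

  markov : ∀ k m {f : RealFun} {A : 2^ω → Bool} {c} → (∀ x → 0# ≤ f x) →
    (∀ x → A x ≡ true → c ≤ f x) → ∀ x → E k m (𝟙 ∘ A) x * c ≤ E k m f x
  markov k m {f} {A} {c} 0≤f A⇒c≤f x = ≤-respˡ-≈ (E-* k m (𝟙 ∘ A) c x) (E-mono k m pointwise x)
    where
    pointwise : ∀ y → 𝟙 (A y) * c ≤ f y
    pointwise y with A y in eq
    ... | true  = ≤-respˡ-≈ (sym (*-identityˡ c)) (A⇒c≤f y eq)
    ... | false = ≤-respˡ-≈ (sym (zeroˡ c)) (0≤f y)

  overwrite : ∀ {l} → 2^ω → ℕ → Vec Bool l → 2^ω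
  overwrite x a []      = x
  overwrite x a (b ∷ s) = overwrite (x [ a ≔ b ]) (suc a) s

  overwrite-outside : ∀ {l} x a (s : Vec Bool l) {i} → ¬ (i ∈[ a ,+ l ⟩) → overwrite x a s i ≡ x i
  overwrite-outside x a []      i∉ = ≡.refl
  overwrite-outside {suc l} x a (b ∷ s) {i} i∉ = ≡.trans
    (overwrite-outside (x [ a ≔ b ]) (suc a) s λ (a<i , i<) →
      i∉ (ℕₚ.<⇒≤ a<i , ≡.subst (i ℕ.<_) (≡.sym (ℕₚ.+-suc a l)) i<))
    ([≔]-minimal x a b λ { ≡.refl → i∉ (ℕₚ.≤-refl , ℕₚ.m<m+n i (ℕ.s≤s ℕ.z≤n)) })

  ↾-suc : ∀ x a l → x ↾ ⟨ a , suc l ⟩ ≡ x a ∷ (x ↾ ⟨ suc a , l ⟩)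
  ↾-suc x a l = ≡.cong₂ _∷_ (≡.cong x (ℕₚ.+-identityʳ a)) (tabulate-cong λ i → ≡.cong x (ℕₚ.+-suc a (toℕ i)))

  ↾-cong : ∀ {x y} a l → (∀ i → i ∈[ a ,+ l ⟩ → x i ≡ y i) → x ↾ ⟨ a , l ⟩ ≡ y ↾ ⟨ a , l ⟩
  ↾-cong {x} {y} a zero    x≐y = ≡.refl
  ↾-cong {x} {y} a (suc l) x≐y = ≡.trans (↾-suc x a l) (≡.trans
    (≡.cong₂ _∷_ (x≐y a (ℕₚ.≤-refl , ℕₚ.m<m+n a (ℕ.s≤s ℕ.z≤n)))
      (↾-cong (suc a) l λ i (a<i , i<) → x≐y i (ℕₚ.<⇒≤ a<i , ≡.subst (i ℕ.<_) (≡.sym (ℕₚ.+-suc a l)) i<)))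
    (≡.sym (↾-suc y a l)))

  overwrite-inside : ∀ x a l y {i} → i ∈[ a ,+ l ⟩ → overwrite x a (y ↾ ⟨ a , l ⟩) i ≡ y i
  overwrite-inside x a zero    y {i} (a≤i , i<) =
      contradiction (≡.subst (i ℕ.<_) (ℕₚ.+-identityʳ a) i<) (ℕₚ.≤⇒≯ a≤i)
  overwrite-inside x a (suc l) y {i} (a≤i , i<) =
    ≡.trans (≡.cong (λ s → overwrite x a s i) (↾-suc y a l)) (go (i ℕₚ.≟ a))
    where
    go : Dec (i ≡ a) → overwrite (x [ a ≔ y a ]) (suc a) (y ↾ ⟨ suc a , l ⟩) i ≡ y i
    go (yes ≡.refl) = ≡.trans
      (overwrite-outside (x [ a ≔ y a ]) (suc a) (y ↾ ⟨ suc a , l ⟩) λ (a<a , _) → ℕₚ.<-irrefl ≡.refl a<a)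
      ([≔]-updates x a (y a) ≡.refl)
    go (no i≢a)     = overwrite-inside (x [ a ≔ y a ]) (suc a) l y
      (ℕₚ.≤∧≢⇒< a≤i (i≢a ∘ ≡.sym) , ≡.subst (i ℕ.<_) (ℕₚ.+-suc a l) i<)

  overwrite-↾ : ∀ {l} x a (s : Vec Bool l) → overwrite x a s ↾ ⟨ a , l ⟩ ≡ s
  overwrite-↾ x a []      = ≡.refl
  overwrite-↾ {suc l} x a (b ∷ s) = ≡.trans (↾-suc (overwrite (x [ a ≔ b ]) (suc a) s) a l) (≡.cong₂ _∷_
    (≡.trans (overwrite-outside (x [ a ≔ b ]) (suc a) s λ (a<a , _) → ℕₚ.<-irrefl ≡.refl a<a)
        ([≔]-updates x a b ≡.refl))
    (overwrite-↾ (x [ a ≔ b ]) (suc a) s))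

  -- The sum in μ, over an arbitrary list of words.
  mass : ∀ a {l} → (Vec Bool l → Bool) → List (Vec Bool l) → Carrier
  mass a J ss = foldr (λ s r → weight a s + r) 0# (filterᵇ J ss)

  mass-++ : ∀ a {l} (J : Vec Bool l → Bool) ss ts → mass a J (ss ++ ts) ≈ mass a J ss + mass a J ts
  mass-++ a J []       ts = sym (+-identityˡ _)
  mass-++ a J (s ∷ ss) ts with J s
  ... | true  = trans (+-congˡ (mass-++ a J ss ts)) (sym (+-assoc _ _ _))
  ... | false = mass-++ a J ss ts

  mass-∷ : ∀ a {l} (J : Vec Bool (suc l) → Bool) b ss →
    mass a J (List.map (b ∷_) ss) ≈ prob a b * mass (suc a) (J ∘ (b ∷_)) ss
  mass-∷ a J b []       = sym (zeroʳ _)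
  mass-∷ a J b (s ∷ ss) with J (b ∷ s)
  ... | true  = trans (+-congˡ (mass-∷ a J b ss)) (sym (distribˡ _ _ _))
  ... | false = mass-∷ a J b ss

  -- Splitting the words by their first bit gives the sum in `μ` the same recursion as `E`. Measures
  -- of cylinders can thus be computed as averages.
  μ-overwrite : ∀ a l x (A : 2^ω → Bool) → μ (⟨ a , l ⟩ , (A ∘ overwrite x a)) ≈ E a l (𝟙 ∘ A) x
  μ-overwrite a zero    x A with A x
  ... | true  = +-identityʳ 1#
  ... | false = refl
  μ-overwrite a (suc l) x A = trans (mass-++ a J (List.map (false ∷_) (words l)) _)
    (+-cong (lem false) (lem true))
    where
    J : Vec Bool (suc l) → Bool
    J = A ∘ overwrite x a
    lem : ∀ b → mass a J (List.map (b ∷_) (words l)) ≈ prob a b * E (suc a) l (𝟙 ∘ A) (x [ a ≔ b ])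
    lem b = trans (mass-∷ a J b (words l)) (*-congˡ (μ-overwrite (suc a) l (x [ a ≔ b ]) A))

  mass-cong : ∀ a {l} {J K : Vec Bool l → Bool} → (∀ s → J s ≡ K s) → ∀ ss → mass a J ss ≡ mass a K ss
  mass-cong a J≗K []       = ≡.refl
  mass-cong a {J = J} {K} J≗K (s ∷ ss) with J s | K s | J≗K s
  ... | true  | true  | _ = ≡.cong (weight a s +_) (mass-cong a J≗K ss)
  ... | false | false | _ = mass-cong a J≗K ss

  indicator : Cylinder → RealFun
  indicator (I , J) x = 𝟙 (J (x ↾ I))

  μ-indicator : ∀ C x → E (start (base C)) (length (base C)) (indicator C) x ≈ μ C
  μ-indicator (⟨ a , l ⟩ , J) x = trans (sym (μ-overwrite a l x (λ y → J (y ↾ ⟨ a , l ⟩))))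
    (reflexive (mass-cong a (λ s → ≡.cong J (overwrite-↾ x a s)) (words l)))

  -- Outer measure and step functions

  ≤-infimum : ∀ {S : Pred 2^ω 0ℓ} {c} → (∀ {r} → CoverBound S r → c ≤ r) → c ≤ μ* S
  ≤-infimum {S} = proj₂ (proj₂ (outer S))

  coverBound⇒μ*≤ : ∀ {S r} → CoverBound S r → μ* S ≤ r
  coverBound⇒μ*≤ {S} = proj₁ (proj₂ (outer S))

  -- Cover bounds are closed upwards. If `r` were not one of them, all of them would be at least
  -- `r`, and so would their infimum.
  μ*<⇒coverBound : ∀ {S r} → μ* S < r → CoverBound S r
  μ*<⇒coverBound {S} {r} μ*S<r with em {CoverBound S r}
  ... | yes bound = bound
  ... | no ¬bound = contradiction (≤-infimum below) (<⇒≱ μ*S<r)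
    where
    below : ∀ {r′} → CoverBound S r′ → r ≤ r′
    below (C , S⊆ , Σ≤r′) = ≰⇒≥ λ r′≤r → ¬bound (C , S⊆ , λ N → ≤-trans (Σ≤r′ N) r′≤r)

  μ*-mono : ∀ {S T} → S ⊆ T → μ* S ≤ μ* T
  μ*-mono S⊆T = ≤-infimum λ (C , T⊆ , Σ≤r) → coverBound⇒μ*≤ (C , (λ x∈S → T⊆ (S⊆T x∈S)) , Σ≤r)

  coverBound-∪ : ∀ {S T U a b} → S ⊆ T ∪ U → CoverBound T a → CoverBound U b → CoverBound S (a + b)
  coverBound-∪ {S} {T} {U} {a} {b} S⊆ (C , T⊆ , ΣC≤a) (D , U⊆ , ΣD≤b) =
    interleave C D , cover ,
    λ N → ≤-trans (partialSum-interleave μ-nonNeg C D N) (+-mono-≤ (ΣC≤a N) (ΣD≤b N))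
    where
    cover : S ⊆ ⋃ ℕ (λ n → ⟦ interleave C D n ⟧)
    cover {x} x∈S with S⊆ x∈S
    ... | inj₁ x∈T with n , eq ← interleave-∃ˡ C D (proj₁ (T⊆ x∈T)) =
      n , ≡.subst (λ A → x ∈ ⟦ A ⟧) (≡.sym eq) (proj₂ (T⊆ x∈T))
    ... | inj₂ x∈U with n , eq ← interleave-∃ʳ C D (proj₁ (U⊆ x∈U)) =
      n , ≡.subst (λ A → x ∈ ⟦ A ⟧) (≡.sym eq) (proj₂ (U⊆ x∈U))

  -- The infimum is taken over one cover at a time, with the other bound moved to the opposite side
  -- of the inequality.
  μ*-∪ : ∀ {S T U} → S ⊆ T ∪ U → μ* S ≤ μ* T + μ* U
  μ*-∪ {S} {T} {U} S⊆ = ≤-respʳ-≈ (+-comm _ _) (x-z≤y⇒x≤y+z (≤-infimum λ {b} U≤b →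
    x≤y+z⇒x-z≤y (≤-respʳ-≈ (+-comm _ _) (x-z≤y⇒x≤y+z (≤-infimum λ {a} T≤a →
      x≤y+z⇒x-z≤y (coverBound⇒μ*≤ (coverBound-∪ S⊆ T≤a U≤b)))))))

  null⇒measurable : ∀ {H} → μ* H ≤ 0# → Measurable H
  null⇒measurable {H} null S = antisym (μ*-∪ split) (≤-respʳ-≈ (+-identityˡ _)
    (+-mono-≤ (≤-trans (μ*-mono proj₂) null) (μ*-mono proj₁)))
    where
    split : S ⊆ (S ∩ H) ∪ (S ∩ ∁ H)
    split {x} x∈S with em {x ∈ H}
    ... | yes x∈H = inj₁ (x∈S , x∈H)
    ... | no  x∉H = inj₂ (x∈S , x∉H)

  half+half : ∀ x → x * ½ + x * ½ ≈ x
  half+half x = trans (sym (distribˡ x ½ ½)) (trans (*-congˡ ½+½≈1) (*-identityʳ x))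

  -- Every tail of the sequence of cylinders still covers `H`. If the outer measure were positive, a
  -- tail of total at most half of it would give a contradiction.
  small⇒null : ∀ {H} → Small H → μ* H ≤ 0#
  small⇒null {H} (I , J , _ , often , r , Σ≤r) = stable λ δ≰0 → x+y≰x (*-pos (≰⇒> δ≰0) 0<½)
    (≤-respˡ-≈ (sym (half+half (μ* H))) (bound (≰⇒> δ≰0)))
    where
    C : ℕ → Cylinder
    C n = I n , J n
    bound : 0# < μ* H → μ* H ≤ μ* H * ½
    bound 0<δ with M , tail≤ ← Σ∞-tail (μ-nonNeg ∘ C) Σ≤r (μ* H * ½) (*-pos 0<δ 0<½) =
      coverBound⇒μ*≤ (C ↑ M , cover , tail≤)
      where
      cover : H ⊆ ⋃ ℕ (λ n → ⟦ (C ↑ M) n ⟧)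
      cover {x} x∈H with n , M≤n , hit ← often x∈H M =
        n ℕ.∸ M , ≡.subst (λ k → x ∈ ⟦ C k ⟧) (≡.sym (ℕₚ.m+[n∸m]≡n M≤n)) hit

  -- The `height` is any bound on the relevant coordinates, not the least one, so that sums can take
  -- the maximum of the heights.
  record Step : Set where
    field
      fn      : RealFun
      height  : ℕ
      depends : DependsOn (ℕ._< height) fn
      nonNeg  : ∀ x → 0# ≤ fn x

  open Step

  mean : Step → Carrier
  mean s = E 0 (height s) (fn s) (const false)

  dependsBelow : ∀ s {h} → height s ℕ.≤ h → DependsOn (ℕ._< h) (fn s)
  dependsBelow s hs≤h x≐y = depends s λ i i<hs → x≐y i (ℕₚ.<-≤-trans i<hs hs≤h)

  E≈mean : ∀ s {h} → height s ℕ.≤ h → ∀ x → E 0 h (fn s) x ≈ mean s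
  E≈mean s {h} hs≤h x = begin-equality
    E 0 h (fn s) x
      ≡⟨ ≡.cong (λ n → E 0 n (fn s) x) (≡.sym (ℕₚ.m+[n∸m]≡n hs≤h)) ⟩
    E 0 (hs ℕ.+ (h ℕ.∸ hs)) (fn s) x
      ≈⟨ E-++ 0 hs (h ℕ.∸ hs) (fn s) ≡.refl x ⟩
    E 0 hs (E hs (h ℕ.∸ hs) (fn s)) x
      ≈⟨ E-cong 0 hs (E-independent hs (h ℕ.∸ hs) {S = ℕ._< hs} (depends s)
          λ i i<hs (hs≤i , _) → ℕₚ.<⇒≱ i<hs hs≤i) x ⟩
    E 0 hs (fn s) x
      -- Once all relevant coordinates are averaged out, the result depends on the empty set of
      -- coordinates, so the base point may be changed.
      ≈⟨ E-dependsOn 0 hs {S = ℕ._< hs} {T = λ _ → ⊥} (depends s) (λ i i<hs i∉ → i∉ (ℕ.z≤n , i<hs)) (λ _ ()) ⟩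
    mean s ∎
    where
    hs : ℕ
    hs = height s

  mean-nonNeg : ∀ s → 0# ≤ mean s
  mean-nonNeg s = E-nonNeg 0 (height s) (nonNeg s) _

  0ₛ : Step
  0ₛ = record { fn = const 0# ; height = 0 ; depends = λ _ → refl ; nonNeg = λ _ → ≤-refl }

  infixl 6 _⊕_
  _⊕_ : Step → Step → Step
  s ⊕ t = record
    { fn      = λ x → fn s x + fn t x
    ; height  = height s ℕ.⊔ height t
    ; depends = λ x≐y → +-cong (dependsBelow s (ℕₚ.m≤m⊔n _ _) x≐y) (dependsBelow t (ℕₚ.m≤n⊔m _ _) x≐y)
    ; nonNeg  = λ x → +-nonNeg (nonNeg s x) (nonNeg t x)
    }

  mean-⊕ : ∀ s t → mean (s ⊕ t) ≈ mean s + mean t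
  mean-⊕ s t = trans (E-+ 0 (height (s ⊕ t)) (fn s) (fn t) _)
    (+-cong (E≈mean s (ℕₚ.m≤m⊔n _ _) _) (E≈mean t (ℕₚ.m≤n⊔m (height s) _) _))

  ∑ₛ : (ℕ → Step) → ℕ → Step
  ∑ₛ s zero    = 0ₛ
  ∑ₛ s (suc N) = s 0 ⊕ ∑ₛ (s ∘ suc) N

  mean-∑ₛ : ∀ s N → mean (∑ₛ s N) ≈ partialSum (mean ∘ s) N
  mean-∑ₛ s zero    = refl
  mean-∑ₛ s (suc N) = trans (mean-⊕ (s 0) (∑ₛ (s ∘ suc) N)) (+-congˡ (mean-∑ₛ (s ∘ suc) N))

  term≤∑ₛ : ∀ s {i N} → i ℕ.< N → ∀ x → fn (s i) x ≤ fn (∑ₛ s N) x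
  term≤∑ₛ s {zero}  {suc N} _           x = x≤x+y (nonNeg (∑ₛ (s ∘ suc) N) x)
  term≤∑ₛ s {suc i} {suc N} (ℕ.s≤s i<N) x = ≤-trans (term≤∑ₛ (s ∘ suc) i<N x) (x≤y+x (nonNeg (s 0) x))

  height≤∑ₛ : ∀ s {i N} → i ℕ.< N → height (s i) ℕ.≤ height (∑ₛ s N)
  height≤∑ₛ s {zero}  {suc N} _           = ℕₚ.m≤m⊔n _ _
  height≤∑ₛ s {suc i} {suc N} (ℕ.s≤s i<N) = ℕₚ.≤-trans (height≤∑ₛ (s ∘ suc) i<N) (ℕₚ.m≤n⊔m (height (s 0)) _)

  ∑ₛ-height≤ : ∀ s N {h} → (∀ {i} → i ℕ.< N → height (s i) ℕ.≤ h) → height (∑ₛ s N) ℕ.≤ h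
  ∑ₛ-height≤ s zero    s≤h = ℕ.z≤n
  ∑ₛ-height≤ s (suc N) s≤h = ℕₚ.⊔-lub (s≤h (ℕ.s≤s ℕ.z≤n)) (∑ₛ-height≤ (s ∘ suc) N (s≤h ∘ ℕ.s≤s))

  χ : Cylinder → Step
  χ C@(⟨ a , l ⟩ , J) = record
    { fn      = indicator C
    ; height  = a ℕ.+ l
    ; depends = λ x≐y → reflexive (≡.cong (𝟙 ∘ J) (↾-cong a l λ i (_ , i<) → x≐y i i<))
    ; nonNeg  = λ x → 0≤𝟙 (J (x ↾ ⟨ a , l ⟩))
    }

  mean-χ : ∀ C → mean (χ C) ≈ μ C
  mean-χ C@(⟨ a , l ⟩ , J) = trans (E-++ 0 a l (indicator C) ≡.refl _)
    (trans (E-cong 0 a (μ-indicator C) _) (E-const 0 a (μ C) _))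

  χ-∈ : ∀ C {x} → x ∈ ⟦ C ⟧ → fn (χ C) x ≈ 1#
  χ-∈ C x∈C = reflexive (≡.cong 𝟙 x∈C)

  -- Points chosen bit by bit

  decide : Set → Bool
  decide P = does (em {P})

  decide-complete : ∀ {P} → P → decide P ≡ true
  decide-complete {P} x with em {P}
  ... | yes _ = ≡.refl
  ... | no ¬x = contradiction x ¬x

  decide-sound : ∀ {P} → decide P ≡ true → P
  decide-sound {P} _ with em {P}
  ... | yes x = x

  decide-cong : ∀ {P Q} → (P → Q) → (Q → P) → decide P ≡ decide Q
  decide-cong {P} {Q} f g with em {P} | em {Q}
  ... | yes _ | yes _ = ≡.refl
  ... | no _  | no _  = ≡.refl
  ... | yes x | no ¬y = contradiction (f x) ¬y
  ... | no ¬x | yes y = contradiction (g y) ¬x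

  μ*⟦⟧≤μ : ∀ C → μ* ⟦ C ⟧ ≤ μ C
  μ*⟦⟧≤μ C = coverBound⇒μ*≤ (cover , (λ x∈C → 0 , x∈C) , bound)
    where
    cover : ℕ → Cylinder
    cover zero    = C
    cover (suc _) = ⟨ 0 , 0 ⟩ , const false
    bound : Σ∞ (μ ∘ cover) ≤ μ C
    bound zero    = μ-nonNeg C
    bound (suc N) = ≤-respʳ-≈ (+-identityʳ _) (+-monoʳ-≤ (μ C) (zeros N))

  -- The conditional expectation of `s` given the coordinates below `k`. For `k` beyond the height
  -- the truncated difference is 0 and the function itself is left.
  cond : Step → ℕ → RealFun
  cond s k = E k (height s ℕ.∸ k) (fn s)

  cond-nonNeg : ∀ s k x → 0# ≤ cond s k x
  cond-nonNeg s k = E-nonNeg k (height s ℕ.∸ k) (nonNeg s)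

  cond-decided : ∀ s {k} → height s ℕ.≤ k → ∀ x → cond s k x ≡ fn s x
  cond-decided s {k} h≤k x = ≡.cong (λ m → E k m (fn s) x) (ℕₚ.m≤n⇒m∸n≡0 h≤k)

  -- The martingale property. Beyond the height both sides are the value of `s`, which no longer
  -- depends on coordinate `k`.
  cond-average : ∀ s k x → cond s k x ≈ E₁ k (cond s (suc k)) x
  cond-average s k x with height s ℕₚ.≤? k
  ... | yes h≤k = trans (reflexive (cond-decided s h≤k x))
    (sym (trans (E₁-cong k (λ y → reflexive (cond-decided s (ℕₚ.m≤n⇒m≤1+n h≤k) y)) x)
      (E-independent k 1 {S = ℕ._< height s} (depends s) (λ i i<h (k≤i , _) → ℕₚ.<⇒≱ i<h (ℕₚ.≤-trans h≤k k≤i)) x)))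
  ... | no h≰k  = reflexive (≡.cong (λ m → E k m (fn s) x) (ℕₚ.+-∸-assoc 1 (ℕₚ.≰⇒> h≰k)))

  -- The method of conditional expectations for countably many martingales at once: each bit is
  -- chosen so that the sum of the whole series does not rise above `r`.
  descend : ∀ {r} (a : ℕ → ℕ → RealFun) → (∀ k i x → 0# ≤ a k i x) →
    (∀ k i x → a k i x ≈ E₁ k (a (suc k) i) x) →
    ∀ {x} → Σ∞ (λ i → a 0 i x) ≤ r → ∀ k → ∃ λ y → Σ∞ (λ i → a k i y) ≤ r
  descend a 0≤a average {x} Σ≤r zero    = x , Σ≤r
  descend a 0≤a average {x} Σ≤r (suc k)
    with y , Σ≤r′ ← descend a 0≤a average Σ≤r k
    with convexCombination-choice (prob-nonNeg k false) (prob-nonNeg k true) (prob-sum k)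
           (λ i → 0≤a (suc k) i (y [ k ≔ false ])) (λ i → 0≤a (suc k) i (y [ k ≔ true ]))
           (λ N → ≤-respˡ-≈ (partialSum-cong (λ i → average k i y) N) (Σ≤r′ N))
  ... | inj₁ Σ≤r″ = y [ k ≔ false ] , Σ≤r″
  ... | inj₂ Σ≤r″ = y [ k ≔ true ] , Σ≤r″

  module BitwiseLimit {H : ℕ} (z : ℕ → 2^ω) (b : ℕ → Bool)
    (step : ∀ j i → z (suc j) i ≡ (z j [ j ℕ.+ H ≔ b j ]) i) where

    limit : 2^ω
    -- Stage `suc i` has settled all coordinates below `suc i + H`, hence coordinate `i` whatever
    -- `H` is.
    limit i = z (suc i) i

    frozen : ∀ {j i} → i ℕ.< j ℕ.+ H → ∀ t → z (t ℕ.+ j) i ≡ z j i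
    frozen i< zero = ≡.refl
    frozen {j} {i} i< (suc t) = ≡.trans (step (t ℕ.+ j) i) (≡.trans
      ([≔]-minimal (z (t ℕ.+ j)) _ _ (ℕₚ.<⇒≢ (ℕₚ.<-≤-trans i< (ℕₚ.+-monoˡ-≤ H (ℕₚ.m≤n+m j t)))))
      (frozen i< t))

    limit-agrees : ∀ j {i} → i ℕ.< j ℕ.+ H → limit i ≡ z j i
    limit-agrees j {i} i< = ≡.trans (≡.sym (frozen (ℕₚ.m≤m+n (suc i) H) j))
      (≡.trans (≡.cong (λ n → z n i) (ℕₚ.+-comm j (suc i))) (frozen i< (suc i)))

    limit-bit : ∀ j → limit (j ℕ.+ H) ≡ b j
    limit-bit j = ≡.trans (limit-agrees (suc j) ℕₚ.≤-refl)
      (≡.trans (step j (j ℕ.+ H)) ([≔]-updates (z j) (j ℕ.+ H) (b j) ≡.refl))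

  module _ (d : ℕ → Step) {r : Carrier} where

    -- Both points share a single series, so that one choice of a pair of bits controls them
    -- together.
    record BoundedPair (k : ℕ) (x y : 2^ω) : Set where
      constructor bounded
      field
        pairBound : Σ∞ (λ i → cond (d i) k x + cond (d i) k y) ≤ r

    open BoundedPair public

    -- The bits are (0,0), (1,0), (0,1) with probabilities 1 - 2p, p, p, so that
    -- each of them has its own distribution; this is where p ≤ ½ enters.
    disjointStep : ∀ k {x y} → BoundedPair k x y →
      ∃₂ λ b c → b ∧ c ≡ false × BoundedPair (suc k) (x [ k ≔ b ]) (y [ k ≔ c ])
    disjointStep k {x} {y} (bounded Σ≤r) = pick (convexCombination-choice 0≤δ 0≤2p δ+2p≈1
      (λ i → 0≤pair i false false)
      (λ i → +-nonNeg (*-nonNeg 0≤½ (0≤pair i true false)) (*-nonNeg 0≤½ (0≤pair i false true)))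
      (λ N → ≤-respˡ-≈ (partialSum-cong rearrange N) (Σ≤r N)))
      where
      δ : Carrier
      δ = prob k false + - p k
      δ+p≈q : δ + p k ≈ prob k false
      δ+p≈q = x-y+y≈x _ _
      0≤δ : 0# ≤ δ
      0≤δ = x≤y⇒0≤y-x (p≤prob k false)
      0≤2p : 0# ≤ p k + p k
      0≤2p = +-nonNeg (prob-nonNeg k true) (prob-nonNeg k true)
      δ+2p≈1 : δ + (p k + p k) ≈ 1#
      δ+2p≈1 = trans (sym (+-assoc _ _ _)) (trans (+-congʳ δ+p≈q) (prob-sum k))
      pair : ℕ → Bool → Bool → Carrier
      pair i b c = cond (d i) (suc k) (x [ k ≔ b ]) + cond (d i) (suc k) (y [ k ≔ c ])
      0≤pair : ∀ i b c → 0# ≤ pair i b c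
      0≤pair i b c = +-nonNeg (cond-nonNeg (d i) (suc k) _) (cond-nonNeg (d i) (suc k) _)
      rearrange : ∀ i → cond (d i) k x + cond (d i) k y ≈
        δ * pair i false false + (p k + p k) * (½ * pair i true false + ½ * pair i false true)
      rearrange i = begin-equality
        cond (d i) k x + cond (d i) k y
          ≈⟨ +-cong (cond-average (d i) k x) (cond-average (d i) k y) ⟩
        (prob k false * x₀ + p k * x₁) + (prob k false * y₀ + p k * y₁)
          ≈⟨ +-cong (+-congʳ (*-congʳ (sym δ+p≈q))) (+-congʳ (*-congʳ (sym δ+p≈q))) ⟩
        ((δ + p k) * x₀ + p k * x₁) + ((δ + p k) * y₀ + p k * y₁)
          ≈⟨ solve 6 (λ e q a b u v → ((e :+ q) :* a :+ q :* b) :+ ((e :+ q) :* u :+ q :* v) :=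
               e :* (a :+ u) :+ con 1 :* (q :* ((b :+ u) :+ (a :+ v)))) refl δ (p k) x₀ x₁ y₀ y₁ ⟩
        -- The explicit factor `1#` is about to become `½ + ½`: the mass `2p` goes to an even
        -- mixture of the pairs (1,0) and (0,1).
        δ * (x₀ + y₀) + 1# * (p k * ((x₁ + y₀) + (x₀ + y₁)))
          ≈⟨ +-congˡ (*-congʳ (sym ½+½≈1)) ⟩
        δ * (x₀ + y₀) + (½ + ½) * (p k * ((x₁ + y₀) + (x₀ + y₁)))
          ≈⟨ +-congˡ (solve 4 (λ h q s t → (h :+ h) :* (q :* (s :+ t)) := (q :+ q) :* (h :* s :+ h :* t))
               refl ½ (p k) (x₁ + y₀) (x₀ + y₁)) ⟩
        δ * (x₀ + y₀) + (p k + p k) * (½ * (x₁ + y₀) + ½ * (x₀ + y₁)) ∎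
        where
        x₀ x₁ y₀ y₁ : Carrier
        x₀ = cond (d i) (suc k) (x [ k ≔ false ])
        x₁ = cond (d i) (suc k) (x [ k ≔ true ])
        y₀ = cond (d i) (suc k) (y [ k ≔ false ])
        y₁ = cond (d i) (suc k) (y [ k ≔ true ])
      pick : (Σ∞ (λ i → pair i false false) ≤ r) ⊎ (Σ∞ (λ i → ½ * pair i true false + ½ * pair i false true) ≤ r) →
        ∃₂ λ b c → b ∧ c ≡ false × BoundedPair (suc k) (x [ k ≔ b ]) (y [ k ≔ c ])
      pick (inj₁ le) = false , false , ≡.refl , bounded le
      pick (inj₂ le) with convexCombination-choice 0≤½ 0≤½ ½+½≈1
                            (λ i → 0≤pair i true false) (λ i → 0≤pair i false true) le
      ... | inj₁ le′ = true , false , ≡.refl , bounded le′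
      ... | inj₂ le′ = false , true , ≡.refl , bounded le′

    module DisjointLimit (H : ℕ) (u : 2^ω) (bounded₀ : BoundedPair H u u) where

      stage : ∀ j → ∃₂ λ x y → BoundedPair (j ℕ.+ H) x y
      nextBits : ∀ j → ∃₂ λ b c → b ∧ c ≡ false ×
        BoundedPair (suc (j ℕ.+ H)) (proj₁ (stage j) [ j ℕ.+ H ≔ b ]) (proj₁ (proj₂ (stage j)) [ j ℕ.+ H ≔ c ])
      stage zero    = u , u , bounded₀
      stage (suc j) = _ , _ , proj₂ (proj₂ (proj₂ (nextBits j)))
      nextBits j = disjointStep (j ℕ.+ H) (proj₂ (proj₂ (stage j)))

      xs ys : ℕ → 2^ω
      xs j = proj₁ (stage j)
      ys j = proj₁ (proj₂ (stage j))

      bs cs : ℕ → Bool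
      bs j = proj₁ (nextBits j)
      cs j = proj₁ (proj₂ (nextBits j))

      module X = BitwiseLimit xs bs (λ j i → ≡.refl)
      module Y = BitwiseLimit ys cs (λ j i → ≡.refl)

      disjoint : ∀ {i} → H ℕ.≤ i → X.limit i ∧ Y.limit i ≡ false
      disjoint {i} H≤i = ≡.subst (λ n → X.limit n ∧ Y.limit n ≡ false) (ℕₚ.m∸n+n≡m H≤i)
        (≡.trans (≡.cong₂ _∧_ (X.limit-bit j) (Y.limit-bit j)) (proj₁ (proj₂ (proj₂ (nextBits j)))))
        where
        j : ℕ
        j = i ℕ.∸ H

      -- At stage `height (d i)` all coordinates relevant to `d i` are settled, so the conditional
      -- expectations are the values at the limits. Their sum is a single term of a nonnegative
      -- series bounded by `r`.
      limits≤r : ∀ i → fn (d i) X.limit + fn (d i) Y.limit ≤ r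
      limits≤r i = begin
        fn (d i) X.limit + fn (d i) Y.limit
          ≈⟨ +-cong (depends (d i) λ n n<h → X.limit-agrees j (ℕₚ.<-≤-trans n<h (ℕₚ.m≤m+n j H)))
                    (depends (d i) λ n n<h → Y.limit-agrees j (ℕₚ.<-≤-trans n<h (ℕₚ.m≤m+n j H))) ⟩
        fn (d i) (xs j) + fn (d i) (ys j)
          ≡⟨ ≡.sym (≡.cong₂ _+_ (cond-decided (d i) (ℕₚ.m≤m+n j H) (xs j))
              (cond-decided (d i) (ℕₚ.m≤m+n j H) (ys j))) ⟩
        c i
          ≤⟨ term≤partialSum 0≤c (ℕₚ.n<1+n i) ⟩
        partialSum c (suc i)
          ≤⟨ pairBound (proj₂ (proj₂ (stage j))) (suc i) ⟩
        r ∎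
        where
        j : ℕ
        j = height (d i)
        c : ℕ → Carrier
        c i = cond (d i) (j ℕ.+ H) (xs j) + cond (d i) (j ℕ.+ H) (ys j)
        0≤c : ∀ i → 0# ≤ c i
        0≤c i = +-nonNeg (cond-nonNeg (d i) (j ℕ.+ H) (xs j)) (cond-nonNeg (d i) (j ℕ.+ H) (ys j))

  -- Measurable filters are null

  ∧-⊑ : ∀ {X Y : 2^ω} n → (λ i → X i ∧ Y i) n ≡ true → X n ≡ true × Y n ≡ true
  ∧-⊑ {X} {Y} n eq = ∧-conicalˡ (X n) (Y n) eq , ∧-conicalʳ (X n) (Y n) eq

  module _ {F : Pred 2^ω 0ℓ} (isFilter : IsFilter F) where
    open IsFilter isFilter

    -- The generator `A` is the intersection of all members. Each coordinate below `H` that is not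
    -- in `A` is missing from some member; intersecting `Z` with these finitely many members gives a
    -- member included in `A`.
    finiteMember⇒principal : ∀ {Z} H → Z ∈ F → (∀ {i} → H ℕ.≤ i → Z i ≡ false) →
      ∃ λ A → ∀ X → X ∈ F ⇔ A ⊑ X
    finiteMember⇒principal {Z} H Z∈F finite = A , λ X → mk⇔
      (λ X∈F i i∈A → decide-sound i∈A X X∈F) (λ A⊑X → upward A⊑X A∈F)
      where
      A : 2^ω
      A i = decide (∀ X → X ∈ F → X i ≡ true)
      shrink : ∀ n → ∃ λ Y → Y ∈ F × Y ⊑ Z × (∀ {i} → i ℕ.< n → Y i ≡ true → A i ≡ true)
      shrink zero    = Z , Z∈F , (λ _ eq → eq) , λ ()
      shrink (suc n) with Y , Y∈F , Y⊑Z , Y⊑A ← shrink n with em {∀ X → X ∈ F → X n ≡ true}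
      ... | yes n∈ = Y , Y∈F , Y⊑Z , λ {i} i≤n Yi → go Yi (ℕₚ.m≤n⇒m<n∨m≡n (ℕₚ.≤-pred i≤n))
        where
        go : ∀ {i} → Y i ≡ true → i ℕ.< n ⊎ i ≡ n → A i ≡ true
        go Yi (inj₁ i<n)    = Y⊑A i<n Yi
        go Yi (inj₂ ≡.refl) = decide-complete n∈
      ... | no n∉ with X , ¬X ← ¬∀⇒∃¬ n∉ =
        _ , intersection Y∈F X∈F , (λ i eq → Y⊑Z i (proj₁ (∧-⊑ {Y} {X} i eq))) ,
        λ {i} i≤n eq → go (∧-⊑ {Y} {X} i eq) (ℕₚ.m≤n⇒m<n∨m≡n (ℕₚ.≤-pred i≤n))
        where
        X∈F : X ∈ F
        X∈F = stable λ X∉F → ¬X λ X∈F → contradiction X∈F X∉F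
        go : ∀ {i} → Y i ≡ true × X i ≡ true → i ℕ.< n ⊎ i ≡ n → A i ≡ true
        go (Yi , _) (inj₁ i<n)    = Y⊑A i<n Yi
        go (_ , Xn) (inj₂ ≡.refl) = contradiction (λ _ → Xn) ¬X
      A∈F : A ∈ F
      A∈F with Y , Y∈F , Y⊑Z , Y⊑A ← shrink H = upward Y⊑A′ Y∈F
        where
        Y⊑A′ : Y ⊑ A
        Y⊑A′ i Yi with H ℕₚ.≤? i
        ... | yes H≤i = contradiction (≡.trans (≡.sym (Y⊑Z i Yi)) (finite H≤i)) λ ()
        ... | no H≰i  = Y⊑A (ℕₚ.≰⇒> H≰i) Yi

    -- Follow bits of small conditional measure up to a point u ∈ V at height H, and
    -- from there two points that become disjoint and avoid every D i.
    denseIn⇒finiteMember : ∀ H (V : 2^ω → Bool) → (∀ {x y} → (∀ i → i ℕ.< H → x i ≡ y i) → V x ≡ V y) →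
      (D : ℕ → Cylinder) → (λ x → V x ≡ true) ∩ ∁ F ⊆ ⋃ ℕ (λ n → ⟦ D n ⟧) →
      ∀ {r} → ¬ (1# ≤ r) →
      (∀ N → E 0 H (𝟙 ∘ not ∘ V) (const false) + partialSum (λ i → mean (χ (D i)) + mean (χ (D i))) N ≤ r) →
      ∃ λ Z → Z ∈ F × (∀ {i} → H ℕ.≤ i → Z i ≡ false)
    denseIn⇒finiteMember H V V-dep D covers {r} 1≰r Σ≤r = (λ i → X.limit i ∧ Y.limit i) ,
      intersection (∈F X.limit (λ i → X.limit-agrees 0)
          λ i le → 1≰r (≤-trans le (≤-trans (x≤x+y (nonNeg (d i) Y.limit)) (limits≤r i))))
                   (∈F Y.limit (λ i → Y.limit-agrees 0)
                       λ i le → 1≰r (≤-trans le (≤-trans (x≤y+x (nonNeg (d i) X.limit)) (limits≤r i)))) ,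
      disjoint
      where
      d : ℕ → Step
      d i = χ (D i)
      outside : Step
      outside = record { fn = 𝟙 ∘ not ∘ V ; height = H
        ; depends = λ x≐y → reflexive (≡.cong (𝟙 ∘ not) (V-dep x≐y)) ; nonNeg = λ x → 0≤𝟙 (not (V x)) }
      -- Index 0 is reserved for the complement of `V`: its term at `u` would be 1 if `u` were
      -- outside `V`. Each `D i` counts twice because two points will start from `u`.
      a : ℕ → ℕ → RealFun
      a k zero    x = cond outside k x
      a k (suc i) x = cond (d i) k x + cond (d i) k x
      0≤a : ∀ k i x → 0# ≤ a k i x
      0≤a k zero    x = cond-nonNeg outside k x
      0≤a k (suc i) x = +-nonNeg (cond-nonNeg (d i) k x) (cond-nonNeg (d i) k x)
      average : ∀ k i x → a k i x ≈ E₁ k (a (suc k) i) x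
      average k zero    x = cond-average outside k x
      average k (suc i) x = trans (+-cong (cond-average (d i) k x) (cond-average (d i) k x))
        (sym (E₁-+ k (cond (d i) (suc k)) (cond (d i) (suc k)) x))
      initial : Σ∞ (λ i → a 0 i (const false)) ≤ r
      initial zero    = ≤-trans (+-nonNeg (mean-nonNeg outside) ≤-refl) (Σ≤r 0)
      initial (suc N) = Σ≤r N
      atH : ∃ λ u → Σ∞ (λ i → a H i u) ≤ r
      atH = descend a 0≤a average initial H
      u : 2^ω
      u = proj₁ atH
      u∈V : V u ≡ true
      u∈V with V u in eq
      ... | true  = ≡.refl
      ... | false = contradiction (begin
        1#                                          ≡⟨ ≡.cong (𝟙 ∘ not) (≡.sym eq) ⟩
        fn outside u                                ≡⟨ ≡.sym (cond-decided outside {H} ℕₚ.≤-refl u) ⟩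
        a H 0 u                                     ≤⟨ term≤partialSum {λ i → a H i u} (λ i → 0≤a H i u) {0} {1} (ℕ.s≤s ℕ.z≤n) ⟩
        partialSum (λ i → a H i u) 1                ≤⟨ proj₂ atH 1 ⟩
        r                                           ∎) 1≰r
      bounded₀ : BoundedPair d {r} H u u
      bounded₀ = bounded λ N → ≤-trans (x≤y+x (0≤a H 0 u)) (proj₂ atH (suc N))
      open DisjointLimit d H u bounded₀
      ∈F : ∀ x → (∀ i → i ℕ.< H → x i ≡ u i) → (∀ i → ¬ (1# ≤ fn (d i) x)) → x ∈ F
      ∈F x x≐u x∉D = stable λ x∉F → covered (covers (≡.trans (V-dep x≐u) u∈V , x∉F))
        where
        covered : ¬ (∃ λ i → x ∈ ⟦ D i ⟧)
        covered (i , x∈D) = x∉D i (≤-reflexive (sym (χ-∈ (D i) {x} x∈D)))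

  finiteUnion : (ℕ → Cylinder) → ℕ → 2^ω → Bool
  finiteUnion C N x = decide (∃ λ n → n ℕ.< N × x ∈ ⟦ C n ⟧)

  finiteUnion-height : (ℕ → Cylinder) → ℕ → ℕ
  finiteUnion-height C N = height (∑ₛ (χ ∘ C) N)

  finiteUnion-depends : ∀ C N {x y} → (∀ i → i ℕ.< finiteUnion-height C N → x i ≡ y i) →
    finiteUnion C N x ≡ finiteUnion C N y
  finiteUnion-depends C N {x} {y} x≐y = decide-cong (transport x≐y) (transport λ i i<H → ≡.sym (x≐y i i<H))
    where
    transport : ∀ {x y} → (∀ i → i ℕ.< finiteUnion-height C N → x i ≡ y i) →
      (∃ λ n → n ℕ.< N × x ∈ ⟦ C n ⟧) → ∃ λ n → n ℕ.< N × y ∈ ⟦ C n ⟧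
    transport x≐y (n , n<N , x∈C) = n , n<N , ≡.trans
      (≡.cong (set (C n)) (≡.sym (↾-cong (start (base (C n))) (length (base (C n))) λ i (_ , i<) → x≐y i
        (ℕₚ.<-≤-trans i< (height≤∑ₛ (χ ∘ C) n<N))))) x∈C

  finiteUnion⊆ : ∀ C N → (λ x → finiteUnion C N x ≡ true) ⊆ ⋃ ℕ (λ n → ⟦ C n ⟧)
  finiteUnion⊆ C N {x} x∈V with n , _ , x∈C ← decide-sound {∃ λ n → n ℕ.< N × x ∈ ⟦ C n ⟧} x∈V = n , x∈C

  ⊆-finiteUnion∪tail : ∀ {F : Pred 2^ω 0ℓ} C N → F ⊆ ⋃ ℕ (λ n → ⟦ C n ⟧) →
    F ⊆ ((λ x → finiteUnion C N x ≡ true) ∩ F) ∪ ⋃ ℕ (λ n → ⟦ (C ↑ N) n ⟧)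
  ⊆-finiteUnion∪tail C N covers {x} x∈F with n , x∈C ← covers x∈F with n ℕₚ.<? N
  ... | yes n<N = inj₁ (decide-complete (n , n<N , x∈C) , x∈F)
  ... | no  n≮N = inj₂ (n ℕ.∸ N , ≡.subst (λ k → x ∈ ⟦ C k ⟧) (≡.sym (ℕₚ.m+[n∸m]≡n (ℕₚ.≮⇒≥ n≮N))) x∈C)

  μ*≤E : ∀ H (V : 2^ω → Bool) → (∀ {x y} → (∀ i → i ℕ.< H → x i ≡ y i) → V x ≡ V y) →
    μ* (λ x → V x ≡ true) ≤ E 0 H (𝟙 ∘ V) (const false)
  μ*≤E H V V-dep = ≤-respʳ-≈ (μ-overwrite 0 H (const false) V) (≤-trans (μ*-mono V⊆C) (μ*⟦⟧≤μ C))
    where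
    C : Cylinder
    C = ⟨ 0 , H ⟩ , (V ∘ overwrite (const false) 0)
    V⊆C : (λ x → V x ≡ true) ⊆ ⟦ C ⟧
    V⊆C {x} x∈V = ≡.trans (V-dep λ i i<H → overwrite-inside (const false) 0 H x (ℕ.z≤n , i<H)) x∈V

  𝟙-not : ∀ b → 𝟙 b + 𝟙 (not b) ≈ 1#
  𝟙-not true  = +-identityʳ 1#
  𝟙-not false = +-identityˡ 1#

  measurableFilter⇒null : ∀ {F} → IsFilter F → Nonprincipal F → Measurable F → μ* F ≤ 0#
  measurableFilter⇒null {F} isFilter nonprincipal measurable =
    stable λ m≰0 → Positive.absurd (≰⇒> m≰0)
    where
    module Positive (0<m : 0# < μ* F) where
      η : Carrier
      -- An eighth of the outer measure: `V′ ∩ ∁ F` gets a cover of total `3η`, which two points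
      -- double to `6η`. One more `η` is lost to the tail of `C`, and the last one keeps `r`
      -- strictly below 1.
      η = μ* F * ½ * ½ * ½
      0<η : 0# < η
      0<η = *-pos (*-pos (*-pos 0<m 0<½) 0<½) 0<½
      twice : Carrier → Carrier
      twice x = x + x
      8η≈m : twice (twice (twice η)) ≈ μ* F
      8η≈m = trans (+-cong (+-cong h h) (+-cong h h)) (trans (+-cong (half+half _) (half+half _)) (half+half _))
        where
        h : twice η ≈ μ* F * ½ * ½
        h = half+half _
      x<x+η : ∀ {x} → x < x + η
      x<x+η = x≤x+y (proj₁ 0<η) , λ eq → x+y≰x 0<η (≤-reflexive (sym eq))
      cover : CoverBound F (μ* F + η)
      cover = μ*<⇒coverBound x<x+η
      C : ℕ → Cylinder
      C = proj₁ cover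
      ΣC≤ : Σ∞ (μ ∘ C) ≤ (μ* F + η)
      ΣC≤ = proj₂ (proj₂ cover)
      tail : ∃ λ N → Σ∞ ((μ ∘ C) ↑ N) ≤ η
      tail = Σ∞-tail (μ-nonNeg ∘ C) ΣC≤ η 0<η
      N H : ℕ
      N = proj₁ tail
      H = finiteUnion-height C N
      V : 2^ω → Bool
      V = finiteUnion C N
      V-dep : ∀ {x y} → (∀ i → i ℕ.< H → x i ≡ y i) → V x ≡ V y
      V-dep = finiteUnion-depends C N
      V′ : Pred 2^ω 0ℓ
      V′ x = V x ≡ true
      m≤V∩F+η : μ* F ≤ μ* (V′ ∩ F) + η
      m≤V∩F+η = ≤-trans (μ*-∪ {F} {V′ ∩ F} {tail⋃}
          (λ {x} → ⊆-finiteUnion∪tail {F} C N (λ {y} → proj₁ (proj₂ cover) {y}) {x}))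
        (+-monoʳ-≤ (μ* (V′ ∩ F)) (coverBound⇒μ*≤ {tail⋃} (C ↑ N , (λ x∈ → x∈) , proj₂ tail)))
        where
        tail⋃ : Pred 2^ω 0ℓ
        tail⋃ = ⋃ ℕ (λ n → ⟦ (C ↑ N) n ⟧)
      V≤m+η : μ* V′ ≤ μ* F + η
      V≤m+η = coverBound⇒μ*≤ {V′} (C , (λ {x} → finiteUnion⊆ C N {x}) , ΣC≤)
      V∖F≤2η : μ* (V′ ∩ ∁ F) ≤ twice η
      V∖F≤2η = +-cancelˡ-≤ (μ* (V′ ∩ F)) (begin
        -- Measurability enters here: since `V′` exceeds `F` by at most `η` and `V′ ∩ F` falls short
        -- of `F` by at most `η`, little of `V′` is left outside `F`.
        μ* (V′ ∩ F) + μ* (V′ ∩ ∁ F) ≈⟨ measurable V′ ⟨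
        μ* V′                       ≤⟨ V≤m+η ⟩
        μ* F + η                    ≤⟨ +-monoˡ-≤ η m≤V∩F+η ⟩
        (μ* (V′ ∩ F) + η) + η       ≈⟨ +-assoc _ _ _ ⟩
        μ* (V′ ∩ F) + twice η       ∎)
      cover′ : CoverBound (V′ ∩ ∁ F) (twice η + η)
      cover′ = μ*<⇒coverBound (≤2η+η , λ eq → x+y≰x 0<η (≤-trans (≤-reflexive (sym eq)) V∖F≤2η))
        where
        ≤2η+η : μ* (V′ ∩ ∁ F) ≤ twice η + η
        ≤2η+η = ≤-trans V∖F≤2η (x≤x+y (proj₁ 0<η))
      D : ℕ → Cylinder
      D = proj₁ cover′
      inside outside r : Carrier
      inside = E 0 H (𝟙 ∘ V) (const false)
      outside = E 0 H (𝟙 ∘ not ∘ V) (const false)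
      r = outside + twice (twice η + η)
      inside+outside≈1 : inside + outside ≈ 1#
      inside+outside≈1 = trans (sym (E-+ 0 H (𝟙 ∘ V) (𝟙 ∘ not ∘ V) (const false)))
        (trans (E-cong 0 H (𝟙-not ∘ V) (const false)) (E-const 0 H 1# (const false)))
      V≤inside : μ* V′ ≤ inside
      V≤inside = μ*≤E H V V-dep
      V∩F≤inside : μ* (V′ ∩ F) ≤ inside
      V∩F≤inside = ≤-trans (μ*-mono {V′ ∩ F} {V′} proj₁) V≤inside
      m≤inside+η : μ* F ≤ inside + η
      m≤inside+η = begin
        μ* F                 ≤⟨ m≤V∩F+η ⟩
        μ* (V′ ∩ F) + η      ≤⟨ +-monoˡ-≤ η V∩F≤inside ⟩
        inside + η           ∎
      r+η≤1 : r + η ≤ 1#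
      r+η≤1 = +-cancelʳ-≤ η (begin
        (r + η) + η    ≈⟨ solve 2 (λ o e → ((o :+ ((e :+ e :+ e) :+ (e :+ e :+ e))) :+ e) :+ e :=
                            o :+ (((e :+ e) :+ (e :+ e)) :+ ((e :+ e) :+ (e :+ e)))) refl outside η ⟩
        outside + twice (twice (twice η)) ≈⟨ +-congˡ 8η≈m ⟩
        outside + μ* F ≤⟨ +-monoʳ-≤ outside m≤inside+η ⟩
        outside + (inside + η) ≈⟨ solve 3 (λ o i e → o :+ (i :+ e) := (i :+ o) :+ e) refl outside inside η ⟩
        (inside + outside) + η ≈⟨ +-congʳ inside+outside≈1 ⟩
        1# + η ∎)
      Σ≤r : ∀ M → outside + partialSum (λ i → mean (χ (D i)) + mean (χ (D i))) M ≤ r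
      Σ≤r M = +-monoʳ-≤ outside (≤-respˡ-≈
          (sym (trans (partialSum-+ (mean ∘ χ ∘ D) (mean ∘ χ ∘ D) M) (+-cong means means)))
        (+-mono-≤ (proj₂ (proj₂ cover′) M) (proj₂ (proj₂ cover′) M)))
        where
        means : partialSum (mean ∘ χ ∘ D) M ≈ partialSum (μ ∘ D) M
        means = partialSum-cong (mean-χ ∘ D) M
      finiteMember : ∃ λ Z → Z ∈ F × (∀ {i} → H ℕ.≤ i → Z i ≡ false)
      finiteMember = denseIn⇒finiteMember isFilter H V V-dep D (proj₁ (proj₂ cover′))
        (λ 1≤r → x+y≰x 0<η (≤-trans r+η≤1 1≤r)) Σ≤r
      absurd : ⊥
      absurd = nonprincipal (finiteMember⇒principal isFilter H
          (proj₁ (proj₂ finiteMember)) (proj₂ (proj₂ finiteMember)))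

  -- Null sets as limits superior

  -- The sum of the finitely many `s j i` with `j + i` equal to the given index, which turns a
  -- double sequence into a single one.
  antidiagonalSum : (ℕ → ℕ → Step) → ℕ → Step
  antidiagonalSum s zero    = s 0 0
  antidiagonalSum s (suc d) = s 0 (suc d) ⊕ antidiagonalSum (s ∘ suc) d

  Σ-antidiagonal≤ : ∀ s r → (∀ j → Σ∞ (mean ∘ s j) ≤ r j) →
    ∀ N → partialSum (mean ∘ antidiagonalSum s) N ≤ partialSum r N
  Σ-antidiagonal≤ s r Σ≤r zero    = ≤-refl
  Σ-antidiagonal≤ s r Σ≤r (suc N) = begin
    mean (s 0 0) + partialSum (λ d → mean (s 0 (suc d) ⊕ antidiagonalSum (s ∘ suc) d)) N
      ≈⟨ +-congˡ (trans (partialSum-cong (λ d → mean-⊕ (s 0 (suc d)) (antidiagonalSum (s ∘ suc) d)) N)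
           (partialSum-+ (mean ∘ s 0 ∘ suc) (mean ∘ antidiagonalSum (s ∘ suc)) N)) ⟩
    mean (s 0 0) + (partialSum (mean ∘ s 0 ∘ suc) N + partialSum (mean ∘ antidiagonalSum (s ∘ suc)) N)
      ≈⟨ +-assoc _ _ _ ⟨
    partialSum (mean ∘ s 0) (suc N) + partialSum (mean ∘ antidiagonalSum (s ∘ suc)) N
      ≤⟨ +-mono-≤ (Σ≤r 0 (suc N)) (Σ-antidiagonal≤ (s ∘ suc) (r ∘ suc) (Σ≤r ∘ suc) N) ⟩
    partialSum r (suc N) ∎

  term≤antidiagonalSum : ∀ s j i x → fn (s j i) x ≤ fn (antidiagonalSum s (j ℕ.+ i)) x
  term≤antidiagonalSum s zero    zero    x = ≤-refl
  term≤antidiagonalSum s zero    (suc i) x = x≤x+y (nonNeg (antidiagonalSum (s ∘ suc) i) x)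
  term≤antidiagonalSum s (suc j) i       x =
    ≤-trans (term≤antidiagonalSum (s ∘ suc) j i x) (x≤y+x (nonNeg (s 0 (suc (j ℕ.+ i))) x))

  -- Sums of indicators stand in for unions of cylinders, so reaching `1#` plays the part of
  -- membership.
  InfinitelyOften : (ℕ → Step) → 2^ω → Set
  InfinitelyOften e x = ∀ K → ∃ λ k → K ℕ.≤ k × 1# ≤ fn (e k) x

  -- Row `j` of the array is a cover of total at most `ε j`. A point of `S` is hit in every row, and
  -- a hit in row `j` lies on an antidiagonal of index at least `j`.
  null⇒infinitelyOften : ∀ {S} → μ* S ≤ 0# →
    ∃ λ e → Σ∞ (mean ∘ e) ≤ 1# × (∀ {x} → x ∈ S → InfinitelyOften e x)
  null⇒infinitelyOften {S} null = antidiagonalSum s ,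
    (λ N → ≤-trans (Σ-antidiagonal≤ s ε Σ≤ε N) (Σε≤1 N)) , often
    where
    cover : ∀ j → CoverBound S (ε j)
    cover j = μ*<⇒coverBound {S} (≤-trans null (proj₁ (0<ε j)) ,
      λ eq → <⇒≱ (0<ε j) (≤-respˡ-≈ eq null))
    s : ℕ → ℕ → Step
    s j i = χ (proj₁ (cover j) i)
    Σ≤ε : ∀ j → Σ∞ (mean ∘ s j) ≤ ε j
    Σ≤ε j N = ≤-respˡ-≈ (sym (partialSum-cong (mean-χ ∘ proj₁ (cover j)) N)) (proj₂ (proj₂ (cover j)) N)
    often : ∀ {x} → x ∈ S → InfinitelyOften (antidiagonalSum s) x
    often {x} x∈S j = j ℕ.+ i , ℕₚ.m≤m+n j i ,
      ≤-trans (≤-reflexive (sym (χ-∈ (proj₁ (cover j) i) {x} (proj₂ hit)))) (term≤antidiagonalSum s j i x)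
      where
      hit : ∃ λ i → x ∈ ⟦ proj₁ (cover j) i ⟧
      hit = proj₁ (proj₂ (cover j)) x∈S
      i : ℕ
      i = proj₁ hit

  -- Regrouping along consecutive blocks

  blockStart : (ℕ → ℕ) → ℕ → ℕ
  blockStart ℓ zero    = 0
  blockStart ℓ (suc k) = blockStart ℓ k ℕ.+ ℓ k

  -- A discrete intermediate value theorem by upward search from `K`, with `j` as fuel; `M` need not
  -- be monotone.
  crossing : ∀ (M : ℕ → ℕ) {d} j {K} → M K ℕ.≤ d → d ℕ.< M (K ℕ.+ j) →
      ∃ λ k → K ℕ.≤ k × M k ℕ.≤ d × d ℕ.< M (suc k)
  crossing M {d} zero    {K} MK≤d d< =
      contradiction (≡.subst (λ n → d ℕ.< M n) (ℕₚ.+-identityʳ K) d<) (ℕₚ.≤⇒≯ MK≤d)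
  crossing M {d} (suc j) {K} MK≤d d< with d ℕₚ.<? M (suc K)
  ... | yes d<M = K , ℕₚ.≤-refl , MK≤d , d<M
  ... | no  d≮M with k , K<k , below , above ← crossing M j (ℕₚ.≮⇒≥ d≮M)
      (≡.subst (λ n → d ℕ.< M n) (ℕₚ.+-suc K j) d<) =
    k , ℕₚ.<⇒≤ K<k , below , above

  m<n∸o⇒o+m<n : ∀ {m n o} → m ℕ.< n ℕ.∸ o → o ℕ.+ m ℕ.< n
  m<n∸o⇒o+m<n {m} {n} {o} m< with o ℕₚ.≤? n
  ... | yes o≤n = ≡.subst (o ℕ.+ m ℕ.<_) (ℕₚ.m+[n∸m]≡n o≤n) (ℕₚ.+-monoʳ-< o m<)
  ... | no  o≰n = contradiction (≡.subst (m ℕ.<_) (ℕₚ.m≤n⇒m∸n≡0 (ℕₚ.≰⇒≥ o≰n)) m<) λ ()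

  Σ∞-↑-+ : ∀ {a : ℕ → Carrier} {r} m k → (∀ i → 0# ≤ a i) → Σ∞ (a ↑ m) ≤ r → Σ∞ (a ↑ (m ℕ.+ k)) ≤ r
  Σ∞-↑-+ {a} {r} m k 0≤a Σ≤r N = begin
    partialSum (a ↑ (m ℕ.+ k)) N
      ≈⟨ partialSum-cong (λ i → reflexive (≡.cong a (ℕₚ.+-assoc m k i))) N ⟩
    partialSum ((a ↑ m) ↑ k) N
      ≤⟨ x≤y+x (partialSum-nonNeg (λ i → 0≤a (m ℕ.+ i)) k) ⟩
    partialSum (a ↑ m) k + partialSum ((a ↑ m) ↑ k) N
      ≈⟨ partialSum-↑ (a ↑ m) k N ⟨
    partialSum (a ↑ m) (k ℕ.+ N)
      ≤⟨ Σ≤r (k ℕ.+ N) ⟩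
    r ∎

  record Regrouping (S : Pred 2^ω 0ℓ) : Set where
    field
      ℓ      : ℕ → ℕ
      0<ℓ    : ∀ k → 0 ℕ.< ℓ k
      g      : ℕ → Step
      height≤ : ∀ k → height (g k) ℕ.≤ blockStart ℓ (suc (suc k))
      -- The factor `minWeight` pays for averaging out the coordinates before block `k`. One `ε k`
      -- bounds the measure of the points with a large slice, the other the measure of a slice that
      -- is not large.
      mean≤  : ∀ k → mean (g k) ≤ ε k * (ε k * minWeight 0 (blockStart ℓ k))
      often  : ∀ {x} → x ∈ S → InfinitelyOften g x

  -- The start `n k` is known first; the cut `M k` is then taken so late that the remaining means
  -- fit the budget at `n k`, and block `k` so long that it ends beyond the heights of all `e d`
  -- with `d < M k`. Hence `g k`, the sum of the terms from `M k` up to `M (suc k)`, lives below the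
  -- end of block `suc k`. Should the cuts decrease, the truncated difference makes `g k` the empty
  -- sum.
  regroup : ∀ {S} e → Σ∞ (mean ∘ e) ≤ 1# → (∀ {x} → x ∈ S → InfinitelyOften e x) → Regrouping S
  regroup {S} e Σe≤1 e-often = record
    { ℓ = ℓ ; 0<ℓ = λ k → ℕ.s≤s ℕ.z≤n ; g = g ; height≤ = height≤ ; mean≤ = mean≤ ; often = often }
    where
    budget : ℕ → ℕ → Carrier
    budget k m = ε k * (ε k * minWeight 0 m)
    cut : ∀ k m → ∃ λ M → Σ∞ ((mean ∘ e) ↑ M) ≤ budget k m
    cut k m = Σ∞-tail (mean-nonNeg ∘ e) Σe≤1 (budget k m) (*-pos (0<ε k) (*-pos (0<ε k) (minWeight-pos 0 m)))
    -- Adding k makes the cut points unbounded.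
    cutAt : ℕ → ℕ → ℕ
    cutAt k m = proj₁ (cut k m) ℕ.+ k
    n : ℕ → ℕ
    n zero    = 0
    n (suc k) = n k ℕ.+ suc (height (∑ₛ e (cutAt k (n k))))
    M ℓ : ℕ → ℕ
    M k = cutAt k (n k)
    ℓ k = suc (height (∑ₛ e (M k)))
    n≡ : ∀ k → blockStart ℓ k ≡ n k
    n≡ zero    = ≡.refl
    n≡ (suc k) = ≡.cong (ℕ._+ ℓ k) (n≡ k)
    g : ℕ → Step
    g k = ∑ₛ (e ↑ M k) (M (suc k) ℕ.∸ M k)
    height≤ : ∀ k → height (g k) ℕ.≤ blockStart ℓ (suc (suc k))
    height≤ k = ∑ₛ-height≤ (e ↑ M k) (M (suc k) ℕ.∸ M k) λ {i} i< →
      ℕₚ.≤-trans (height≤∑ₛ e (m<n∸o⇒o+m<n i<))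
          (ℕₚ.≤-trans (ℕₚ.n≤1+n _) (ℕₚ.m≤n+m (ℓ (suc k)) (blockStart ℓ (suc k))))
    mean≤ : ∀ k → mean (g k) ≤ ε k * (ε k * minWeight 0 (blockStart ℓ k))
    mean≤ k = begin
      mean (g k)
        ≈⟨ mean-∑ₛ (e ↑ M k) (M (suc k) ℕ.∸ M k) ⟩
      partialSum ((mean ∘ e) ↑ M k) (M (suc k) ℕ.∸ M k)
        ≤⟨ Σ∞-↑-+ (proj₁ (cut k (n k))) k (mean-nonNeg ∘ e) (proj₂ (cut k (n k))) (M (suc k) ℕ.∸ M k) ⟩
      budget k (n k)
        ≡⟨ ≡.cong (budget k) (≡.sym (n≡ k)) ⟩
      budget k (blockStart ℓ k) ∎
    often : ∀ {x} → x ∈ S → InfinitelyOften g x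
    often {x} x∈S K = locate (e-often x∈S (M K))
      where
      locate : (∃ λ d → M K ℕ.≤ d × 1# ≤ fn (e d) x) → ∃ λ k → K ℕ.≤ k × 1# ≤ fn (g k) x
      -- The fuel `suc d` is enough: `M k` is at least `k`, so `M (K + suc d)` exceeds `d`.
      locate (d , MK≤d , 1≤) = found (crossing M (suc d) MK≤d
        (ℕₚ.≤-trans (ℕₚ.m≤n+m (suc d) K) (ℕₚ.m≤n+m (K ℕ.+ suc d) (proj₁ (cut (K ℕ.+ suc d) (n (K ℕ.+ suc d)))))))
        where
        found : (∃ λ k → K ℕ.≤ k × M k ℕ.≤ d × d ℕ.< M (suc k)) → ∃ λ k → K ℕ.≤ k × 1# ≤ fn (g k) x
        found (k , K≤k , M≤d , d<M) = k , K≤k , ≤-trans 1≤ (≤-trans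
          (≤-reflexive (reflexive (≡.cong (λ i → fn (e i) x) (≡.sym (ℕₚ.m+[n∸m]≡n M≤d)))))
          (term≤∑ₛ (e ↑ M k) (ℕₚ.∸-monoˡ-< d<M M≤d) x))

  -- Null filters are small

  even : ℕ → Bool
  even zero    = true
  even (suc n) = not (even n)

  markov-≤ : ∀ k m {f : RealFun} {A : 2^ω → Bool} {c δ} → 0# < c → (∀ x → 0# ≤ f x) →
    (∀ x → A x ≡ true → c ≤ f x) → ∀ x → E k m f x ≤ δ * c → E k m (𝟙 ∘ A) x ≤ δ
  markov-≤ k m {f} {A} 0<c 0≤f A⇒c≤f x Ef≤ = *-cancelʳ-≤ 0<c (≤-trans (markov k m {f} {A} 0≤f A⇒c≤f x) Ef≤)

  module Blocks (ℓ : ℕ → ℕ) (0<ℓ : ∀ k → 0 ℕ.< ℓ k) where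

    n : ℕ → ℕ
    n = blockStart ℓ

    block : ℕ → Interval
    block k = ⟨ n k , ℓ k ⟩

    n-mono : ∀ {j k} → j ℕ.≤ k → n j ℕ.≤ n k
    n-mono {j} {k} j≤k = ≡.subst (λ i → n j ℕ.≤ n i) (ℕₚ.m∸n+n≡m j≤k) (go (k ℕ.∸ j))
      where
      go : ∀ t → n j ℕ.≤ n (t ℕ.+ j)
      go zero    = ℕₚ.≤-refl
      go (suc t) = ℕₚ.≤-trans (go t) (ℕₚ.m≤m+n _ _)

    k≤n : ∀ k → k ℕ.≤ n k
    k≤n zero    = ℕ.z≤n
    k≤n (suc k) = ≡.subst (ℕ._≤ n k ℕ.+ ℓ k) (ℕₚ.+-comm k 1) (ℕₚ.+-mono-≤ (k≤n k) (0<ℓ k))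

    locate : ∀ K {i} → i ℕ.< n K → ∃ λ k → i ∈ᴵ block k
    locate (suc K) {i} i< with i ℕₚ.<? n K
    ... | yes i<nK = locate K i<nK
    ... | no  i≮nK = K , ℕₚ.≮⇒≥ i≮nK , i<

    blockOf : ∀ i → ∃ λ k → i ∈ᴵ block k
    blockOf i = locate (suc i) (k≤n (suc i))

    blocks-disjoint : ∀ {j k i} → i ∈ᴵ block j → i ∈ᴵ block k → j ≡ k
    blocks-disjoint {j} {k} (nj≤i , i<) (nk≤i , i<′) with ℕₚ.<-cmp j k
    ... | tri≈ _ j≡k _ = j≡k
    ... | tri< j<k _ _ = contradiction (ℕₚ.≤-trans (n-mono j<k) nk≤i) (ℕₚ.<⇒≱ i<)
    ... | tri> _ _ k<j = contradiction (ℕₚ.≤-trans (n-mono k<j) nj≤i) (ℕₚ.<⇒≱ i<′)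

    isIntervalPartition : IsIntervalPartition block
    isIntervalPartition = record { nonempty = 0<ℓ ; covering = blockOf ; disjoint = blocks-disjoint }

    splice : 2^ω → ℕ → 2^ω → 2^ω
    splice x k z = overwrite x (n k) (z ↾ block k)

    splice-inside : ∀ x k z {i} → i ∈ᴵ block k → splice x k z i ≡ z i
    splice-inside x k z = overwrite-inside x (n k) (ℓ k) z

    splice-outside : ∀ x k z {i} → ¬ (i ∈ᴵ block k) → splice x k z i ≡ x i
    splice-outside x k z = overwrite-outside x (n k) (z ↾ block k)

    -- The common last step of both cases. With all other coordinates frozen at `x`, test `u k`
    -- reads block `k` and test `v k` reads block `suc k`, so every hit is seen by a single block.
    small-spliced : ∀ x (u v : ℕ → 2^ω → Bool) →
      (∀ k → E (n k) (ℓ k) (𝟙 ∘ u k) x ≤ ε k) →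
      (∀ k → E (n (suc k)) (ℓ (suc k)) (𝟙 ∘ v k) x ≤ ε k) →
      ∀ {S} → (∀ {z} → z ∈ S → ∀ K → ∃ λ k → K ℕ.≤ k ×
                (u k (splice x k z) ≡ true ⊎ v k (splice x (suc k) z) ≡ true)) →
      Small S
    small-spliced x u v u≤ v≤ {S} hits = block , J , isIntervalPartition , often , 1# + 1# , summable
      where
      -- The tests that read the same block are joined; no `v` test reads block 0, whence the
      -- shifted bound `ε⁻`.
      B : ℕ → 2^ω → Bool
      B zero    y = u zero y
      B (suc k) y = u (suc k) y ∨ v k y
      J : ∀ k → 2^ block k → Bool
      J k s = B k (overwrite x (n k) s)
      u⇒B : ∀ k {y} → u k y ≡ true → B k y ≡ true
      u⇒B zero    uy = uy
      u⇒B (suc k) uy rewrite uy = ≡.refl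
      often : ∀ {z} → z ∈ S → ∀ K → ∃ λ k → K ℕ.≤ k × J k (z ↾ block k) ≡ true
      often {z} z∈S K with hits z∈S K
      ... | k , K≤k , inj₁ uz = k , K≤k , u⇒B k uz
      ... | k , K≤k , inj₂ vz = suc k , ℕₚ.m≤n⇒m≤1+n K≤k ,
          ≡.trans (≡.cong (u (suc k) (splice x (suc k) z) ∨_) vz) (∨-zeroʳ _)
      ε⁻ : ℕ → Carrier
      ε⁻ zero    = 0#
      ε⁻ (suc k) = ε k
      μJ≤ : ∀ k → μ (block k , J k) ≤ ε k + ε⁻ k
      μJ≤ k = ≤-respˡ-≈ (sym (μ-overwrite (n k) (ℓ k) x (B k))) (B≤ k)
        where
        B≤ : ∀ k → E (n k) (ℓ k) (𝟙 ∘ B k) x ≤ ε k + ε⁻ k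
        B≤ zero    = ≤-respʳ-≈ (sym (+-identityʳ _)) (u≤ zero)
        B≤ (suc k) = begin
          E (n (suc k)) (ℓ (suc k)) (𝟙 ∘ B (suc k)) x
            ≤⟨ E-mono (n (suc k)) (ℓ (suc k)) (λ y → 𝟙-∨ (u (suc k) y) (v k y)) x ⟩
          E (n (suc k)) (ℓ (suc k)) (λ y → 𝟙 (u (suc k) y) + 𝟙 (v k y)) x
            ≈⟨ E-+ (n (suc k)) (ℓ (suc k)) (𝟙 ∘ u (suc k)) (𝟙 ∘ v k) x ⟩
          E (n (suc k)) (ℓ (suc k)) (𝟙 ∘ u (suc k)) x + E (n (suc k)) (ℓ (suc k)) (𝟙 ∘ v k) x
            ≤⟨ +-mono-≤ (u≤ (suc k)) (v≤ k) ⟩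
          ε (suc k) + ε k ∎
      Σε⁻≤1 : Σ∞ ε⁻ ≤ 1#
      Σε⁻≤1 zero    = 0≤1
      Σε⁻≤1 (suc N) = ≤-respˡ-≈ (sym (+-identityˡ _)) (Σε≤1 N)
      summable : Σ∞ (λ k → μ (block k , J k)) ≤ (1# + 1#)
      summable N = ≤-trans (partialSum-mono μJ≤ N)
        (≤-respˡ-≈ (sym (partialSum-+ ε ε⁻ N)) (+-mono-≤ (Σε≤1 N) (Σε⁻≤1 N)))

    alternate : 2^ω → 2^ω → 2^ω
    alternate x z i = if even (proj₁ (blockOf i)) then x i else z i

    alternate-even : ∀ {x z k i} → even k ≡ true → i ∈ᴵ block k → alternate x z i ≡ x i
    alternate-even {x} {z} {k} {i} ev i∈ rewrite blocks-disjoint (proj₂ (blockOf i)) i∈ | ev = ≡.refl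

    alternate-odd : ∀ {x z k i} → even k ≡ false → i ∈ᴵ block k → alternate x z i ≡ z i
    alternate-odd {x} {z} {k} {i} ev i∈ rewrite blocks-disjoint (proj₂ (blockOf i)) i∈ | ev = ≡.refl

    alternate-⊒ : ∀ x z → (λ i → x i ∧ z i) ⊑ alternate x z
    alternate-⊒ x z i eq with even (proj₁ (blockOf i))
    ... | true  = ∧-conicalˡ (x i) (z i) eq
    ... | false = ∧-conicalʳ (x i) (z i) eq

  -- Fubini moves the average over the initial segment outermost; the three adjacent intervals then
  -- merge into one that contains all relevant coordinates.
  iteratedE≈mean : ∀ a m l s → height s ℕ.≤ (a ℕ.+ m) ℕ.+ l → ∀ x →
    E a m (E (a ℕ.+ m) l (E 0 a (fn s))) x ≈ mean s
  iteratedE≈mean a m l s h≤ x = begin-equality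
    E a m (E (a ℕ.+ m) l (E 0 a f)) x   ≈⟨ E-cong a m (E-comm 0 a (a ℕ.+ m) l (ℕₚ.m≤m+n a m) f-ext) x ⟨
    E a m (E 0 a (E (a ℕ.+ m) l f)) x   ≈⟨ E-comm 0 a a m ℕₚ.≤-refl (E-extensional (a ℕ.+ m) l f-ext) x ⟨
    E 0 a (E a m (E (a ℕ.+ m) l f)) x   ≈⟨ E-cong 0 a (E-++ a m l f ≡.refl) x ⟨
    E 0 a (E a (m ℕ.+ l) f) x           ≈⟨ E-++ 0 a (m ℕ.+ l) f ≡.refl x ⟨
    E 0 (a ℕ.+ (m ℕ.+ l)) f x           ≈⟨ E≈mean s (ℕₚ.≤-trans h≤ (ℕₚ.≤-reflexive (ℕₚ.+-assoc a m l))) x ⟩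
    mean s                              ∎
    where
    f : RealFun
    f = fn s
    f-ext : Extensional f
    f-ext = extensional {ℕ._< height s} (depends s)

  -- Slices over two adjacent blocks

  module _ {F : Pred 2^ω 0ℓ} (isFilter : IsFilter F) (regrouping : Regrouping F) where
    open IsFilter isFilter
    open Regrouping regrouping
    open Blocks ℓ 0<ℓ

    -- Two thresholds for Markov's inequality: `w k` for `φ k` to count as a hit, `θ k` for a slice
    -- to count as large.
    w θ : ℕ → Carrier
    w k = minWeight 0 (n k)
    θ k = ε k * w k

    0<w : ∀ k → 0# < w k
    0<w k = minWeight-pos 0 (n k)

    0<θ : ∀ k → 0# < θ k
    0<θ k = *-pos (0<ε k) (0<w k)

    -- After `φ k` has averaged out what precedes block `k`, only two blocks matter. `ψˡ k` is the
    -- integral of the slice determined by the left block, `ψʳ k` of the one determined by the right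
    -- block.
    φ ψˡ ψʳ : ℕ → RealFun
    φ k = E 0 (n k) (fn (g k))
    ψˡ k = E (n (suc k)) (ℓ (suc k)) (φ k)
    ψʳ k = E (n k) (ℓ k) (φ k)

    g-ext : ∀ k → Extensional (fn (g k))
    g-ext k = extensional {ℕ._< height (g k)} (depends (g k))

    φ-depends : ∀ k → DependsOn (λ i → i ∈ᴵ block k ⊎ i ∈ᴵ block (suc k)) (φ k)
    φ-depends k = E-dependsOn 0 (n k) {S = ℕ._< height (g k)} (depends (g k)) λ i i<h i∉ →
      side i (ℕₚ.≮⇒≥ (λ i<n → i∉ (ℕ.z≤n , i<n))) (ℕₚ.<-≤-trans i<h (height≤ k))
      where
      side : ∀ i → n k ℕ.≤ i → i ℕ.< n (suc (suc k)) → i ∈ᴵ block k ⊎ i ∈ᴵ block (suc k)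
      side i n≤i i<n″ with i ℕₚ.<? n (suc k)
      ... | yes i<n′ = inj₁ (n≤i , i<n′)
      ... | no  i≮n′ = inj₂ (ℕₚ.≮⇒≥ i≮n′ , i<n″)

    φ-ext : ∀ k → Extensional (φ k)
    φ-ext k = E-extensional 0 (n k) (g-ext k)

    φ-nonNeg : ∀ k x → 0# ≤ φ k x
    φ-nonNeg k = E-nonNeg 0 (n k) (nonNeg (g k))

    ψˡ-nonNeg : ∀ k x → 0# ≤ ψˡ k x
    ψˡ-nonNeg k = E-nonNeg (n (suc k)) (ℓ (suc k)) (φ-nonNeg k)

    ψʳ-nonNeg : ∀ k x → 0# ≤ ψʳ k x
    ψʳ-nonNeg k = E-nonNeg (n k) (ℓ k) (φ-nonNeg k)

    ψˡ-depends : ∀ k → DependsOn (_∈ᴵ block k) (ψˡ k)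
    ψˡ-depends k = E-dependsOn (n (suc k)) (ℓ (suc k)) (φ-depends k)
      λ { i (inj₁ i∈) _ → i∈ ; i (inj₂ i∈) i∉ → contradiction i∈ i∉ }

    ψʳ-depends : ∀ k → DependsOn (_∈ᴵ block (suc k)) (ψʳ k)
    ψʳ-depends k = E-dependsOn (n k) (ℓ k) (φ-depends k)
      λ { i (inj₁ i∈) i∉ → contradiction i∈ i∉ ; i (inj₂ i∈) _ → i∈ }

    Eψˡ≤ : ∀ k x → E (n k) (ℓ k) (ψˡ k) x ≤ ε k * θ k
    Eψˡ≤ k x = ≤-respˡ-≈ (sym (iteratedE≈mean (n k) (ℓ k) (ℓ (suc k)) (g k) (height≤ k) x)) (mean≤ k)

    Eψʳ≤ : ∀ k x → E (n (suc k)) (ℓ (suc k)) (ψʳ k) x ≤ ε k * θ k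
    Eψʳ≤ k x = ≤-respˡ-≈ (E-comm (n k) (ℓ k) (n (suc k)) (ℓ (suc k)) ℕₚ.≤-refl (φ-ext k) x) (Eψˡ≤ k x)

    -- Replaces projecting {g k ≥ 1} along the coordinates below n k.
    1≤g⇒w≤φ : ∀ k x → 1# ≤ fn (g k) x → w k ≤ φ k x
    1≤g⇒w≤φ k x 1≤g = begin
      w k                ≈⟨ *-identityʳ _ ⟨
      w k * 1#           ≤⟨ *-monoˡ-≤ (proj₁ (0<w k)) 1≤g ⟩
      w k * fn (g k) x   ≤⟨ E-minWeight 0 (n k) (g-ext k) (nonNeg (g k)) x ⟩
      φ k x              ∎

    badˡ badʳ : ℕ → 2^ω → Bool
    badˡ k x = decide (θ k ≤ ψˡ k x)
    badʳ k x = decide (θ k ≤ ψʳ k x)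

    LargeSlice : ℕ → 2^ω → Set
    LargeSlice k x = θ k ≤ ψˡ k x ⊎ θ k ≤ ψʳ k x

    -- The means of `ψˡ k` and `ψʳ k` are at most `ε k * θ k`, so each kind of large slice occurs
    -- with measure at most `ε k`, and each is detected on one block.
    largeSlices⇒small : (∀ {x} → x ∈ F → ∀ K → ∃ λ k → K ℕ.≤ k × LargeSlice k x) → Small F
    largeSlices⇒small large = small-spliced (const false) badˡ badʳ
      (λ k → markov-≤ (n k) (ℓ k) {ψˡ k} {badˡ k} (0<θ k) (ψˡ-nonNeg k) (λ x → decide-sound) _ (Eψˡ≤ k _))
      (λ k → markov-≤ (n (suc k)) (ℓ (suc k)) {ψʳ k} {badʳ k} (0<θ k) (ψʳ-nonNeg k) (λ x → decide-sound) _ (Eψʳ≤ k _))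
      hits
      where
      hits : ∀ {z} → z ∈ F → ∀ K → ∃ λ k → K ℕ.≤ k ×
        (badˡ k (splice (const false) k z) ≡ true ⊎ badʳ k (splice (const false) (suc k) z) ≡ true)
      hits {z} z∈F K with large z∈F K
      ... | k , K≤k , inj₁ le = k , K≤k , inj₁ (decide-complete (≤-respʳ-≈
              (ψˡ-depends k λ i i∈ → ≡.sym (splice-inside (const false) k z i∈)) le))
      ... | k , K≤k , inj₂ le = k , K≤k , inj₂ (decide-complete (≤-respʳ-≈
              (ψʳ-depends k λ i i∈ → ≡.sym (splice-inside (const false) (suc k) z i∈)) le))

    smallSlices⇒small : ∀ {x} → x ∈ F → ∀ K₀ → (∀ k → K₀ ℕ.≤ k → ¬ LargeSlice k x) → Small F
    smallSlices⇒small {x} x∈F K₀ slices≤ = small-spliced x hit hit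
      -- Averaging `φ k` over the left block with `x` on the right one is `ψʳ k x` by definition, so
      -- a right slice of `x` bounds the test on the left block, and conversely in the next line.
      (λ k → hit≤ k (n k) (ℓ k) λ K₀≤k → ≰⇒≥ (slices≤ k K₀≤k ∘ inj₂))
      (λ k → hit≤ k (n (suc k)) (ℓ (suc k)) λ K₀≤k → ≰⇒≥ (slices≤ k K₀≤k ∘ inj₁))
      hits
      where
      hit : ℕ → 2^ω → Bool
      -- Nothing is known about the slices of `x` before `K₀`, so the tests are made empty there.
      hit k z = decide (K₀ ℕ.≤ k × w k ≤ φ k z)
      hit≤ : ∀ k a l → (K₀ ℕ.≤ k → E a l (φ k) x ≤ θ k) → E a l (𝟙 ∘ hit k) x ≤ ε k
      hit≤ k a l Eφ≤ with K₀ ℕₚ.≤? k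
      ... | yes K₀≤k = markov-≤ a l {φ k} {hit k} (0<w k) (φ-nonNeg k) (λ z → proj₂ ∘ decide-sound) x (Eφ≤ K₀≤k)
      ... | no  K₀≰k = markov-≤ a l {const 0#} {hit k} (0<w k) (λ _ → ≤-refl)
              (λ z eq → contradiction (proj₁ (decide-sound {K₀ ℕ.≤ k × w k ≤ φ k z} eq)) K₀≰k) x
              (≤-respˡ-≈ (sym (E-const a l 0# x)) (proj₁ (0<θ k)))
      hits : ∀ {z} → z ∈ F → ∀ K → ∃ λ k → K ℕ.≤ k ×
        (hit k (splice x k z) ≡ true ⊎ hit k (splice x (suc k) z) ≡ true)
      hits {z} z∈F K = locateHit (often (upward (alternate-⊒ x z) (intersection x∈F z∈F)) (K₀ ℕ.⊔ K))
        where
        y : 2^ω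
        y = alternate x z
        locateHit : (∃ λ k → K₀ ℕ.⊔ K ℕ.≤ k × 1# ≤ fn (g k) y) → ∃ λ k → K ℕ.≤ k ×
          (hit k (splice x k z) ≡ true ⊎ hit k (splice x (suc k) z) ≡ true)
        locateHit (k , K≤k , 1≤g) = k , ℕₚ.m⊔n≤o⇒n≤o K₀ K K≤k , side (even k) ≡.refl
          where
          hitAt : ∀ y′ → (∀ i → i ∈ᴵ block k ⊎ i ∈ᴵ block (suc k) → y i ≡ y′ i) → hit k y′ ≡ true
          hitAt y′ agree = decide-complete (ℕₚ.m⊔n≤o⇒m≤o K₀ K K≤k ,
            ≤-respʳ-≈ (φ-depends k agree) (1≤g⇒w≤φ k y 1≤g))
          side : ∀ b → even k ≡ b → hit k (splice x k z) ≡ true ⊎ hit k (splice x (suc k) z) ≡ true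
          -- For even `k` the mixture `y` follows `x` on block `k` and `z` on block `suc k`, just as
          -- `splice x (suc k) z` does; for odd `k` the blocks exchange roles.
          side true  ev = inj₂ (hitAt _ λ
            { i (inj₁ i∈) → ≡.trans (alternate-even {x} {z} ev i∈)
                (≡.sym (splice-outside x (suc k) z λ i∈′ → ℕₚ.1+n≢n (≡.sym (blocks-disjoint i∈ i∈′))))
            ; i (inj₂ i∈) → ≡.trans (alternate-odd {x} {z} {suc k} (≡.cong not ev) i∈)
                (≡.sym (splice-inside x (suc k) z i∈)) })
          side false ev = inj₁ (hitAt _ λ
            { i (inj₁ i∈) → ≡.trans (alternate-odd {x} {z} ev i∈) (≡.sym (splice-inside x k z i∈))
            ; i (inj₂ i∈) → ≡.trans (alternate-even {x} {z} {suc k} (≡.cong not ev) i∈)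
                (≡.sym (splice-outside x k z λ i∈′ → ℕₚ.1+n≢n (blocks-disjoint i∈ i∈′))) })

    regrouped⇒small : Small F
    regrouped⇒small with em {∀ x → x ∈ F → ∀ K → ∃ λ k → K ℕ.≤ k × LargeSlice k x}
    ... | yes large = largeSlices⇒small λ {x} → large x
    ... | no ¬large = smallSlices⇒small x∈F K₀ λ k K₀≤k slice → ¬k (k , K₀≤k , slice)
      where
      x₀ = proj₁ (¬∀⇒∃¬ ¬large)
      ¬x₀ = proj₂ (¬∀⇒∃¬ ¬large)
      x∈F : x₀ ∈ F
      x∈F = stable λ x∉F → ¬x₀ λ x∈F → contradiction x∈F x∉F
      ¬all : ¬ (∀ K → ∃ λ k → K ℕ.≤ k × LargeSlice k x₀)
      ¬all all = ¬x₀ λ _ → all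
      K₀ = proj₁ (¬∀⇒∃¬ ¬all)
      ¬k = proj₂ (¬∀⇒∃¬ ¬all)

  nullFilter⇒small : ∀ {F} → IsFilter F → μ* F ≤ 0# → Small F
  nullFilter⇒small isFilter null with e , Σe≤1 , often ← null⇒infinitelyOften null =
    regrouped⇒small isFilter (regroup e Σe≤1 often)

theorem1p1 : ExcludedMiddle 0ℓ →
    (ℝ : CompleteOrderedField) → let open CompleteOrderedField ℝ in
    (p : ℕ → Carrier) (p∈⟨0,½] : ∀ n → p n ∈ ⟨0,½]) →
    let open ProductMeasure ℝ p p∈⟨0,½] in
    (F : Pred 2^ω 0ℓ) → IsFilter F → Nonprincipal F →
    Measurable F ⇔ Small F
theorem1p1 em ℝ p p∈⟨0,½] F isFilter nonprincipal = mk⇔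
  (λ measurable → nullFilter⇒small isFilter (measurableFilter⇒null isFilter nonprincipal measurable))
  (λ small → null⇒measurable (small⇒null small))
  where open FilterMeasure em ℝ p p∈⟨0,½]
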